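{- Let $p$ be a prime, $l\ge 1$ an integer, and let $f\colon\mathbb{Z}_p\to\mathbb{Q}_p$ be an analytic function that is not identically zero. Let $\mathcal{R}_f\subset\mathbb{Z}_p$ be the set of roots of $f$ in $\mathbb{Z}_p$. Then the sequence $(\nu_{p^l}(f(n)))_{n\ge 0}$ is (a) periodic if $\mathcal{R}_f=\varnothing$, and a power of $p$ can be chosen as a period; (b) strictly $p$-regular if $\varnothing\ne\mathcal{R}_f\subset\mathbb{Q}$; (c) not regular if $\mathcal{R}_f\not\subset\mathbb{Q}$. In particular, these conditions do not depend on $l$.
   Context: $\mathbb{N}=\{0,1,2,\ldots\}$. A function $f\colon\mathbb{Z}_p\to\mathbb{Q}_p$ is analytic if it is given by a single Taylor (power) series convergent on all of $\mathbb{Z}_p$. For $x\in\mathbb{Q}_p$ put $\nu_{p^l}(x)=\lfloor\nu_p(x)/l\rfloor$, with $\nu_{p^l}(0)=+\infty$. For an integer $k\ge2$, the $k$-kernel of a sequence $\mathbf{a}=(a_n)_{n\ge0}$ is $\{(a_{k^in+j})_{n\ge0}: i\ge0,\ 0\le j\le k^i-1\}$. A sequence with values in a $\mathbb{Z}$-module $R$ is $k$-regular if the $\mathbb{Z}$-submodule of $R^{\mathbb{N}}$ generated by its $k$-kernel is finitely generated. It is regular if it is $k$-regular for some $k\ge2$. It is strictly $k$-regular if it is $k$-regular and is not $m$-regular for any integer $m\ge2$ multiplicatively independent of $k$ (i.e. with $k^a\neq m^c$ for all integers $a,c\ge1$). A period need not be minimal. Convention: $f$ may have (finitely many) roots in $\mathbb{N}$;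 the terms $+\infty$ occurring at such $n$ are replaced by arbitrary integers, which does not affect regularity. -}

module Defs where

open import Algebra.Bundles.Raw using (RawRing)
import Algebra.Definitions.RawSemiring as RawSemiringDefinitions
open import Data.Fin.Base using (toℕ)
open import Data.Integer.Base as ℤ using (ℤ; +_; -[1+_])
open import Data.Integer.DivMod using (_/ℕ_)
open import Data.Integer.Divisibility.Signed
  using (_∣_; ∣m∣n⇒∣m+n; ∣m⇒∣-m; ∣n⇒∣m*n; ∣m⇒∣m*n; divides)
open import Data.Integer.Tactic.RingSolver using (solve-∀)
open import Data.List.Base using (List)
open import Data.List.Membership.Propositional using (_∈_)
open import Data.Nat.Base as ℕ using (ℕ; zero; suc)
open import Data.Product.Base using (Σ-syntax; ∃-syntax; _×_)
open import Data.Rational.Base using (ℚ; ↥_; ↧_)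
open import Level using (0ℓ)
open import Relation.Binary.PropositionalEquality
  using (_≡_; _≢_; _≗_; subst; sym)
open import Relation.Nullary using (¬_)
open import Relation.Unary using (Pred; _⊆_; _≐_)

-- All notions below are read classically: the theorem assumes excluded
-- middle.

module _ (p : ℕ) where

  -- ℤₚ is the inverse limit of the rings ℤ/pⁿ.  The n-th residue is given by
  -- an arbitrary integer representative, so equality is _≈ᶻ_, not _≡_.

  record ℤₚ : Set where
    constructor mkℤₚ
    field
      residue  : ℕ → ℤ
      coherent : ∀ n → + (p ℕ.^ n) ∣ residue (suc n) ℤ.- residue n

  open ℤₚ

  infix  4 _≈ᶻ_
  infixl 6 _+ᶻ_
  infixl 7 _*ᶻ_

  _≈ᶻ_ : ℤₚ → ℤₚ → Set
  x ≈ᶻ y = ∀ n → + (p ℕ.^ n) ∣ residue x n ℤ.- residue y n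

  fromℤ : ℤ → ℤₚ
  fromℤ a = mkℤₚ (λ _ → a) (λ _ → divides (+ 0) (a-a≡0 a))
    where
    a-a≡0 : ∀ a → a ℤ.- a ≡ + 0
    a-a≡0 = solve-∀

  _+ᶻ_ : ℤₚ → ℤₚ → ℤₚ
  x +ᶻ y = mkℤₚ (λ n → residue x n ℤ.+ residue y n) λ n →
    subst (_ ∣_)
      (sym (split (residue x (suc n)) (residue x n) (residue y (suc n)) (residue y n)))
      (∣m∣n⇒∣m+n (coherent x n) (coherent y n))
    where
    split : ∀ a a′ b b′ → (a ℤ.+ b) ℤ.- (a′ ℤ.+ b′) ≡ (a ℤ.- a′) ℤ.+ (b ℤ.- b′)
    split = solve-∀

  -ᶻ_ : ℤₚ → ℤₚ
  -ᶻ x = mkℤₚ (λ n → ℤ.- residue x n) λ n →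
    subst (_ ∣_)
      (sym (split (residue x (suc n)) (residue x n)))
      (∣m⇒∣-m (coherent x n))
    where
    split : ∀ a a′ → (ℤ.- a) ℤ.- (ℤ.- a′) ≡ ℤ.- (a ℤ.- a′)
    split = solve-∀

  _*ᶻ_ : ℤₚ → ℤₚ → ℤₚ
  x *ᶻ y = mkℤₚ (λ n → residue x n ℤ.* residue y n) λ n →
    subst (_ ∣_)
      (sym (split (residue x (suc n)) (residue x n) (residue y (suc n)) (residue y n)))
      (∣m∣n⇒∣m+n
        (∣m⇒∣m*n (residue y (suc n)) (coherent x n))
        (∣n⇒∣m*n (residue x n) (coherent y n)))
    where
    split : ∀ a a′ b b′ →
            a ℤ.* b ℤ.- a′ ℤ.* b′ ≡ (a ℤ.- a′) ℤ.* b ℤ.+ a′ ℤ.* (b ℤ.- b′)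
    split = solve-∀

  p^ : ℕ → ℤₚ
  p^ k = fromℤ (+ (p ℕ.^ k))

  -- ℚₚ = ℤₚ[1/p]:  x /p^ k  stands for x · p⁻ᵏ.

  infix 5 _/p^_

  record ℚₚ : Set where
    constructor _/p^_
    field
      numerator : ℤₚ
      exponent  : ℕ

  ℚₚ-rawRing : RawRing 0ℓ 0ℓ
  ℚₚ-rawRing = record
    { Carrier = ℚₚ
    ; _≈_     = λ { (x /p^ k) (y /p^ m) → p^ m *ᶻ x ≈ᶻ p^ k *ᶻ y }
    ; _+_     = λ { (x /p^ k) (y /p^ m) → (p^ m *ᶻ x +ᶻ p^ k *ᶻ y) /p^ (k ℕ.+ m) }
    ; _*_     = λ { (x /p^ k) (y /p^ m) → (x *ᶻ y) /p^ (k ℕ.+ m) }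
    ; -_      = λ { (x /p^ k) → (-ᶻ x) /p^ k }
    ; 0#      = fromℤ (+ 0) /p^ 0
    ; 1#      = fromℤ (+ 1) /p^ 0
    }

  open RawRing ℚₚ-rawRing using (_≈_; _+_; _*_; -_; 0#)
  open RawSemiringDefinitions (RawRing.rawSemiring ℚₚ-rawRing) using (_^_; sum)

  ι : ℤₚ → ℚₚ
  ι x = x /p^ 0

  -- The limit of s is y:  for every k, eventually s N - y ∈ pᵏℤₚ.

  ConvergesTo : (ℕ → ℚₚ) → ℚₚ → Set
  ConvergesTo s y =
    ∀ k → ∃[ N₀ ] ∀ N → N₀ ℕ.≤ N → ∃[ w ] s N + - y ≈ ι (p^ k *ᶻ w)

  -- f need not be assumed to respect _≈ᶻ_: limits are unique up to _≈_, so
  -- analyticity implies it.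

  Analytic : (ℤₚ → ℚₚ) → Set
  Analytic f = Σ[ c ∈ (ℕ → ℚₚ) ] ∀ x →
    ConvergesTo (λ N → sum {N} (λ i → c (toℕ i) * ι x ^ toℕ i)) (f x)

  IdenticallyZero : (ℤₚ → ℚₚ) → Set
  IdenticallyZero f = ∀ x → f x ≈ 0#

  Roots : (ℤₚ → ℚₚ) → Pred ℤₚ 0ℓ
  Roots f x = f x ≈ 0#

  -- The elements of ℤₚ that lie in ℚ.

  Rational : Pred ℤₚ 0ℓ
  Rational x = ∃[ q ] fromℤ (↧ q) *ᶻ x ≈ᶻ fromℤ (↥ q)

  IsUnit : Pred ℤₚ 0ℓ
  IsUnit u = ∃[ w ] u *ᶻ w ≈ᶻ fromℤ (+ 1)

  p^ℤ : ℤ → ℚₚ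
  p^ℤ (+ k)    = ι (p^ k)
  p^ℤ -[1+ k ] = fromℤ (+ 1) /p^ suc k

  -- HasValuation x v says that νₚ(x) is the (finite) integer v; it holds for
  -- no v exactly when x ≈ 0#.

  HasValuation : ℚₚ → ℤ → Set
  HasValuation x v = ∃[ u ] IsUnit u × x ≈ p^ℤ v * ι u

  -- a is the sequence of the ⌊νₚ(f(n)) / l⌋, where the value +∞ at a root
  -- n ∈ ℕ of f is replaced by an arbitrary integer: a n is unconstrained there.
  -- _/ℕ_ rounds towards -∞.

  IsValuationSequence : (l : ℕ) .{{_ : ℕ.NonZero l}} → (ℤₚ → ℚₚ) → (ℕ → ℤ) → Set
  IsValuationSequence l f a =
    ∀ n v → HasValuation (f (fromℤ (+ n))) v → a n ≡ v /ℕ l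

Seq : Set
Seq = ℕ → ℤ

HasPeriod : Seq → ℕ → Set
HasPeriod a T = 0 ℕ.< T × (∀ n → a (n ℕ.+ T) ≡ a n)

Periodic : Seq → Set
Periodic a = ∃[ T ] HasPeriod a T

Kernel : ℕ → Seq → Pred Seq 0ℓ
Kernel k a s = ∃[ i ] ∃[ j ] j ℕ.< k ℕ.^ i × s ≗ (λ n → a (k ℕ.^ i ℕ.* n ℕ.+ j))

-- The ℤ-submodule of ℤ^ℕ generated by S.

data ⟨_⟩ (S : Pred Seq 0ℓ) : Pred Seq 0ℓ where
  generator : ∀ {s} → S s → ⟨ S ⟩ s
  zeroˢ     : ⟨ S ⟩ (λ _ → + 0)
  addˢ      : ∀ {s t} → ⟨ S ⟩ s → ⟨ S ⟩ t → ⟨ S ⟩ (λ n → s n ℤ.+ t n)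
  scaleˢ    : ∀ m {s} → ⟨ S ⟩ s → ⟨ S ⟩ (λ n → m ℤ.* s n)
  respˢ     : ∀ {s t} → s ≗ t → ⟨ S ⟩ s → ⟨ S ⟩ t

FinitelyGenerated : Pred Seq 0ℓ → Set
FinitelyGenerated M = ∃[ gs ] M ≐ ⟨ _∈ gs ⟩

RegularFor : ℕ → Seq → Set
RegularFor k a = 2 ℕ.≤ k × FinitelyGenerated ⟨ Kernel k a ⟩

Regular : Seq → Set
Regular a = ∃[ k ] RegularFor k a

MultiplicativelyIndependent : ℕ → ℕ → Set
MultiplicativelyIndependent k m = ∀ a c → 1 ℕ.≤ a → 1 ℕ.≤ c → k ℕ.^ a ≢ m ℕ.^ c

StrictlyRegularFor : ℕ → Seq → Set
StrictlyRegularFor k a = RegularFor k a ×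
  (∀ m → 2 ℕ.≤ m → MultiplicativelyIndependent k m → ¬ RegularFor m a)

-- Up to a power of p, f is the limit F of integer polynomials modulo pᴸ.  Dividing
-- out a root lowers the degree modulo a suitable p^V, so near a root α the order
-- of F (x) is c + m ν(x - α), and away from the roots it is locally constant; by
-- compactness this holds uniformly on the residue classes modulo some pᴱ.  If
-- there is no root, the sequence is periodic.  If all roots are rational, the
-- k-kernel for k = p involves only finitely many (α - j) / pⁱ, up to constants
-- and values at roots.  Conversely, near a root the values satisfy
-- φ (v + l) = φ (v) + m as functions of the order v.  A finitely generated module
-- of integer sequences is finite modulo m + 1, so for any k two kernel elements
-- agree modulo m + 1; this forces their singular points (α - j) / kⁱ to coincide,
-- which is impossible unless k is a power of p and α is rational.
module Submission where

open import Defs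
open import Algebra.Bundles.Raw using (RawRing; RawSemiring)
import Algebra.Definitions.RawSemiring as RawSemiringDefinitions
open import Axiom.ExcludedMiddle using (ExcludedMiddle)
open import Data.Bool.Base using (if_then_else_)
open import Data.Empty using (⊥-elim)
open import Data.Fin.Base as Fin using (Fin; toℕ; fromℕ<; combine; remQuot)
import Data.Fin.Properties as FinP
open import Data.Integer.Base as ℤ using (ℤ; +_; -[1+_]; _+_; _*_; _-_; -_)
open import Data.Integer.DivMod using (_%ℕ_; _/ℕ_; n%ℕd<d; a≡a%ℕn+[a/ℕn]*n)
open import Data.Integer.Divisibility.Signed
import Data.Integer.GCD as ℤG
import Data.Integer.Properties as ℤP
open import Data.Integer.Tactic.RingSolver using (solve-∀)
open import Data.List.Base using (List; []; _∷_; _++_; map; drop; applyUpTo)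
open import Data.List.Membership.Propositional using (_∈_)
open import Data.List.Membership.Propositional.Properties using (∈-++⁺ˡ; ∈-++⁺ʳ; ∈-map⁺; ∈-applyUpTo⁺)
open import Data.List.Relation.Unary.Any using (here; there)
open import Data.Nat.Base as ℕ using (ℕ; zero; suc; _^_; NonZero; _≤_; _<_; z≤n; s≤s)
open import Data.Nat.Coprimality using (Coprime; coprime-Bézout)
import Data.Nat.Divisibility as ℕD
open import Data.Nat.DivMod using (m≡m%n+[m/n]*n; m%n<n; m<n*o⇒m/o<n)
open import Data.Nat.GCD using (module Bézout)
open import Data.Nat.Primality using (Prime; prime⇒nonZero; prime⇒nonTrivial; prime⇒irreducible; euclidsLemma)
import Data.Nat.Properties as ℕP
open import Data.Nat.Tactic.RingSolver using () renaming (solve-∀ to ℕ-solve-∀)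
open import Data.Product.Base using (Σ-syntax; ∃; ∃-syntax; _×_; _,_; proj₁; proj₂)
open import Data.Rational.Base using (ℚ; ↥_; ↧_; ↧ₙ_; _/_)
open import Data.Rational.Properties using (↥-/; ↧-/)
open import Data.Sum.Base using (_⊎_; inj₁; inj₂)
open import Function.Base using (_∘_)
open import Function.Bundles using (_⇔_; mk⇔)
open import Level using (0ℓ)
open import Relation.Binary.Definitions using (tri<; tri≈; tri>)
open import Relation.Binary.PropositionalEquality
open import Relation.Nullary using (¬_; Dec; yes; no; does)
open import Relation.Unary using (Empty; Satisfiable; Pred; _⊆_; _∪_)

-- The modulus `m + 1` is chosen because `φ v` and `φ (v + l)`, which differ by `m >= 1`, stay
-- distinct modulo it. If two kernel elements have different singular points, then close to the
-- singular point of one of them the other is constant, while the first one takes both values. Write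
-- `k = p^t κ` with `κ` prime to `p`: at level `i` exactly `κ^i` offsets `j < k^i` agree with `α`
-- modulo `p^(ti)`. If `κ > 1`, a single level holds more such offsets than there are classes modulo
-- `m + 1`, and equal singular points on one level mean equal offsets, a contradiction. If `κ = 1`,
-- there is one such offset per level, so the repetition occurs between two levels, and it becomes a
-- linear equation for `α` with nonzero leading coefficient. On the regular side, placing a kernel
-- inside a finitely generated module does not yet give generators of its span; this is where the
-- Noetherian property of the integers enters.

-- Congruences between integers

-- Opaque, so that no equality proof found by a solver is ever evaluated.
opaque
  ∣-resp-≡ : ∀ {d a b} → a ≡ b → d ∣ b → d ∣ a
  ∣-resp-≡ refl d∣b = d∣b

∣-difference-refl : ∀ {d} a → d ∣ a - a
∣-difference-refl a = divides (+ 0) (ℤP.+-inverseʳ a)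

∣-difference-sym : ∀ {d} a b → d ∣ a - b → d ∣ b - a
∣-difference-sym a b d∣a-b = ∣-resp-≡ (swap a b) (∣m⇒∣-m d∣a-b)
  where
  swap : ∀ a b → b - a ≡ - (a - b)
  swap = solve-∀

∣-difference-trans : ∀ {d} a b c → d ∣ a - b → d ∣ b - c → d ∣ a - c
∣-difference-trans a b c d∣a-b d∣b-c = ∣-resp-≡ (split a b c) (∣m∣n⇒∣m+n d∣a-b d∣b-c)
  where
  split : ∀ a b c → a - c ≡ (a - b) + (b - c)
  split = solve-∀

∣-transfer : ∀ {d} a b → d ∣ a - b → d ∣ b → d ∣ a
∣-transfer a b d∣a-b d∣b = ∣-resp-≡ (split a b) (∣m∣n⇒∣m+n d∣a-b d∣b)
  where
  split : ∀ a b → a ≡ (a - b) + b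
  split = solve-∀

n<m^n : ∀ {m} → 1 < m → ∀ n → n < m ^ n
n<m^n 1<m zero = s≤s z≤n
n<m^n {m} 1<m (suc n) = ℕP.≤-<-trans (n<m^n 1<m n) (ℕP.^-monoʳ-< m 1<m (ℕP.n<1+n n))

-- The order of p-adic integers

module Valuation (p : ℕ) (p-prime : Prime p) where

  private instance
    p-nonZero : NonZero p
    p-nonZero = prime⇒nonZero p-prime

  1<p : 1 < p
  1<p = ℕ.nonTrivial⇒n>1 p {{prime⇒nonTrivial p-prime}}

  P : ℕ → ℤ
  P k = + (p ^ k)

  P-nonZero : ∀ k → NonZero (p ^ k)
  P-nonZero k = ℕP.m^n≢0 p k

  P-+ : ∀ m n → P (m ℕ.+ n) ≡ P m * P n
  P-+ m n = trans (cong +_ (ℕP.^-distribˡ-+-* p m n)) (ℤP.pos-* (p ^ m) (p ^ n))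

  P-mono : ∀ {m n} → m ≤ n → P m ∣ P n
  P-mono {m} {n} m≤n = divides (P (n ℕ.∸ m))
    (trans (cong P (sym (ℕP.m∸n+n≡m m≤n))) (P-+ (n ℕ.∸ m) m))

  P-∣-* : ∀ k n {a} → P n ∣ a → P (k ℕ.+ n) ∣ P k * a
  P-∣-* k n {a} n∣a = subst (λ d → d ∣ P k * a) (sym (P-+ k n)) (*-monoʳ-∣ (P k) n∣a)

  P-cancel : ∀ k n {a} → P (k ℕ.+ n) ∣ P k * a → P n ∣ a
  P-cancel k n {a} h = *-cancelˡ-∣ (P k) {{P-nonZero k}} (subst (λ d → d ∣ P k * a) (P-+ k n) h)

  -- If `a` is nonzero, the exponent `|a|` already fails, since `|a| < p^|a|`.
  P-∣-all⇒0 : ∀ a → (∀ n → P n ∣ a) → a ≡ + 0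
  P-∣-all⇒0 a h with ℤ.∣ a ∣ in eq | ∣⇒∣ᵤ (h ℤ.∣ a ∣)
  ... | zero | _ = ℤP.∣i∣≡0⇒i≡0 eq
  ... | suc m | d = ⊥-elim (ℕP.<⇒≱ (n<m^n 1<p (suc m)) (ℕD.∣⇒≤ d))

  euclid : ∀ a b → P 1 ∣ a * b → P 1 ∣ a ⊎ P 1 ∣ b
  euclid a b h with euclidsLemma ℤ.∣ a ∣ ℤ.∣ b ∣ p-prime
      (subst₂ ℕD._∣_ (ℕP.*-identityʳ p) (ℤP.abs-* a b) (∣⇒∣ᵤ h))
  ... | inj₁ d = inj₁ (∣ᵤ⇒∣ (subst (ℕD._∣ ℤ.∣ a ∣) (sym (ℕP.*-identityʳ p)) d))
  ... | inj₂ d = inj₂ (∣ᵤ⇒∣ (subst (ℕD._∣ ℤ.∣ b ∣) (sym (ℕP.*-identityʳ p)) d))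

  ¬P1∣1 : ¬ P 1 ∣ + 1
  ¬P1∣1 d = ℕP.<⇒≱ 1<p (ℕP.≤-trans (ℕP.≤-reflexive (sym (ℕP.*-identityʳ p))) (ℕD.∣⇒≤ (∣⇒∣ᵤ d)))

  Exact : ℕ → ℤ → Set
  Exact v a = P v ∣ a × ¬ P (suc v) ∣ a

  exact-unit-part : ∀ {v a b} → ¬ P (suc v) ∣ a → a ≡ b * P v → ¬ P 1 ∣ b
  exact-unit-part {v} {a} {b} ¬d a≡ d =
    ¬d (subst₂ _∣_ (cong P (ℕP.+-comm v 1)) (trans (ℤP.*-comm (P v) b) (sym a≡)) (P-∣-* v 1 d))

  -- Primality enters here: the cofactors `a′` and `b′` are prime to `p`, hence so is their product.
  exact-* : ∀ {v w a b} → Exact v a → Exact w b → Exact (v ℕ.+ w) (a * b)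
  exact-* {v} {w} {a} {b} (divides a′ a≡ , ¬a) (divides b′ b≡ , ¬b) =
    divides (a′ * b′) ab≡ , λ d →
      case-euclid (euclid a′ b′ (P-cancel (v ℕ.+ w) 1
        (subst₂ _∣_ (cong P (ℕP.+-comm 1 (v ℕ.+ w))) (trans ab≡ (ℤP.*-comm (a′ * b′) (P (v ℕ.+ w)))) d)))
    where
    swap : ∀ a b c d → (a * b) * (c * d) ≡ (a * c) * (b * d)
    swap = solve-∀
    ab≡ : a * b ≡ (a′ * b′) * P (v ℕ.+ w)
    ab≡ = trans (cong₂ _*_ a≡ b≡)
      (trans (swap a′ (P v) b′ (P w)) (cong ((a′ * b′) *_) (sym (P-+ v w))))
    case-euclid : ¬ (P 1 ∣ a′ ⊎ P 1 ∣ b′)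
    case-euclid (inj₁ d) = exact-unit-part {v} ¬a a≡ d
    case-euclid (inj₂ d) = exact-unit-part {w} ¬b b≡ d

  open ℤₚ public

  infix  4 _≈_
  infixl 6 _⊕_ _⊖_
  infixl 7 _⊛_

  Zp : Set
  Zp = ℤₚ p

  _≈_ : Zp → Zp → Set
  _≈_ = _≈ᶻ_ p

  _⊕_ _⊖_ _⊛_ : Zp → Zp → Zp
  _⊕_ = _+ᶻ_ p
  _⊛_ = _*ᶻ_ p
  x ⊖ y = x ⊕ -ᶻ_ p y

  int : ℤ → Zp
  int = fromℤ p

  nat : ℕ → Zp
  nat n = int (+ n)

  ≈-sym : ∀ {x y} → x ≈ y → y ≈ x
  ≈-sym {x} {y} e n = ∣-difference-sym (residue x n) (residue y n) (e n)

  ≈-trans : ∀ {x y z} → x ≈ y → y ≈ z → x ≈ z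
  ≈-trans {x} {y} {z} e e′ n =
    ∣-difference-trans (residue x n) (residue y n) (residue z n) (e n) (e′ n)

  ≈-pointwise : ∀ {x y} → (∀ n → residue x n ≡ residue y n) → x ≈ y
  ≈-pointwise {x} {y} e n =
    ∣-resp-≡ (cong (_- residue y n) (e n)) (∣-difference-refl (residue y n))

  coherent-≤ : ∀ x {m n} → m ≤ n → P m ∣ residue x n - residue x m
  coherent-≤ x m≤n with ℕP.≤⇒≤′ m≤n
  ... | ℕ.≤′-refl = ∣-difference-refl (residue x _)
  ... | ℕ.≤′-step {n} m≤′n = ∣-difference-trans (residue x (suc n)) (residue x n) (residue x _)
    (∣-trans (P-mono (ℕP.≤′⇒≤ m≤′n)) (coherent x n)) (coherent-≤ x (ℕP.≤′⇒≤ m≤′n))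

  -- The residue at index `k` is meaningful modulo `p^k` only, just enough to decide divisibility by
  -- `p^k`. By coherence every later residue gives the same answer.
  Ord≥ : ℕ → Zp → Set
  Ord≥ k x = P k ∣ residue x k

  Ord : ℕ → Zp → Set
  Ord v x = Ord≥ v x × ¬ Ord≥ (suc v) x

  residue-∣⇒Ord≥ : ∀ x {k n} → k ≤ n → P k ∣ residue x n → Ord≥ k x
  residue-∣⇒Ord≥ x {k} {n} k≤n d = ∣-transfer (residue x k) (residue x n)
    (∣-difference-sym (residue x n) (residue x k) (coherent-≤ x k≤n)) d

  Ord≥⇒residue-∣ : ∀ x {k n} → k ≤ n → Ord≥ k x → P k ∣ residue x n
  Ord≥⇒residue-∣ x {k} {n} k≤n d = ∣-transfer (residue x n) (residue x k) (coherent-≤ x k≤n) d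

  Ord≥-antitone : ∀ x {j k} → j ≤ k → Ord≥ k x → Ord≥ j x
  Ord≥-antitone x j≤k d = residue-∣⇒Ord≥ x j≤k (∣-trans (P-mono j≤k) d)

  Ord≥-0 : ∀ x → Ord≥ 0 x
  Ord≥-0 x = divides (residue x 0) (sym (ℤP.*-identityʳ (residue x 0)))

  Ord⇒Exact : ∀ x {v n} → v < n → Ord v x → Exact v (residue x n)
  Ord⇒Exact x v<n (d , ¬d) =
    Ord≥⇒residue-∣ x (ℕP.<⇒≤ v<n) d , λ d′ → ¬d (residue-∣⇒Ord≥ x v<n d′)

  Exact⇒Ord : ∀ x {v n} → v < n → Exact v (residue x n) → Ord v x
  Exact⇒Ord x v<n (d , ¬d) =
    residue-∣⇒Ord≥ x (ℕP.<⇒≤ v<n) d , λ d′ → ¬d (Ord≥⇒residue-∣ x v<n d′)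

  Ord≥-resp-≈ : ∀ {x y} k → x ≈ y → Ord≥ k x → Ord≥ k y
  Ord≥-resp-≈ {x} {y} k x≈y d = ∣-transfer (residue y k) (residue x k) (≈-sym {x} {y} x≈y k) d

  Ord-resp-≈ : ∀ {x y v} → x ≈ y → Ord v x → Ord v y
  Ord-resp-≈ {x} {y} {v} x≈y (d , ¬d) =
    Ord≥-resp-≈ {x} {y} v x≈y d , λ d′ → ¬d (Ord≥-resp-≈ {y} {x} (suc v) (≈-sym {x} {y} x≈y) d′)

  Ord-unique : ∀ {x v w} → Ord v x → Ord w x → v ≡ w
  Ord-unique {x} {v} {w} (d , ¬d) (d′ , ¬d′) with ℕP.<-cmp v w
  ... | tri< v<w _ _ = ⊥-elim (¬d (Ord≥-antitone x v<w d′))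
  ... | tri≈ _ v≡w _ = v≡w
  ... | tri> _ _ w<v = ⊥-elim (¬d′ (Ord≥-antitone x w<v d))

  Ord-* : ∀ {x y v w} → Ord v x → Ord w y → Ord (v ℕ.+ w) (x ⊛ y)
  Ord-* {x} {y} {v} {w} ox oy = Exact⇒Ord (x ⊛ y) (ℕP.n<1+n (v ℕ.+ w))
    (exact-* {v} {w} (Ord⇒Exact x (s≤s (ℕP.m≤m+n v w)) ox) (Ord⇒Exact y (s≤s (ℕP.m≤n+m w v)) oy))

  Ord≥-⊕ : ∀ {x y} k → Ord≥ k x → Ord≥ k y → Ord≥ k (x ⊕ y)
  Ord≥-⊕ k = ∣m∣n⇒∣m+n

  Ord-⊕ : ∀ {x y v} → Ord v x → Ord≥ (suc v) y → Ord v (x ⊕ y)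
  Ord-⊕ {x} {y} {v} (d , ¬d) dy =
    Ord≥-⊕ {x} {y} v d (Ord≥-antitone y (ℕP.n≤1+n v) dy) ,
    λ d′ → ¬d (∣m+n∣n⇒∣m {m = residue x (suc v)} d′ dy)

  Ord-P : ∀ k → Ord k (int (P k))
  Ord-P k = ∣-refl , λ d → ¬P1∣1 (P-cancel k 1
    (subst₂ _∣_ (cong P (ℕP.+-comm 1 k)) (sym (ℤP.*-identityʳ (P k))) d))

  Ord⇒≉0 : ∀ {x v} → Ord v x → ¬ x ≈ int (+ 0)
  Ord⇒≉0 {x} {v} (_ , ¬d) x≈0 = ¬d (∣-transfer (residue x (suc v)) (+ 0) (x≈0 (suc v)) (divides (+ 0) refl))

  Ord≥-all⇒≈0 : ∀ {x} → (∀ k → Ord≥ k x) → x ≈ int (+ 0)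
  Ord≥-all⇒≈0 {x} h n = ∣-resp-≡ (ℤP.+-identityʳ (residue x n)) (h n)

  ¬Ord≥⇒Ord : ∀ {x} k → ¬ Ord≥ k x → ∃[ v ] v < k × Ord v x
  ¬Ord≥⇒Ord {x} zero ¬d = ⊥-elim (¬d (Ord≥-0 x))
  ¬Ord≥⇒Ord {x} (suc k) ¬d with P k ∣? residue x k
  ... | yes d = k , ℕP.n<1+n k , d , ¬d
  ... | no ¬d′ with ¬Ord≥⇒Ord {x} k ¬d′
  ...   | v , v<k , o = v , ℕP.m<n⇒m<1+n v<k , o

  ⊖≈0⇒≈ : ∀ {x y} → x ⊖ y ≈ int (+ 0) → x ≈ y
  ⊖≈0⇒≈ {x} {y} e n = ∣-resp-≡ (sym (ℤP.+-identityʳ (residue x n - residue y n))) (e n)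

  int-injective : ∀ {a b} → int a ≈ int b → a ≡ b
  int-injective {a} {b} e = ℤP.i-j≡0⇒i≡j a b (P-∣-all⇒0 (a - b) e)

  module _ (em : ExcludedMiddle 0ℓ) where

    by-contradiction : {A : Set} → ¬ ¬ A → A
    by-contradiction {A} ¬¬a with em {A}
    ... | yes a = a
    ... | no ¬a = ⊥-elim (¬¬a ¬a)

    ¬∀⇒∃¬ : {A : Set} {B : A → Set} → ¬ (∀ x → B x) → ∃[ x ] ¬ B x
    ¬∀⇒∃¬ ¬∀ = by-contradiction λ ¬∃ → ¬∀ λ x → by-contradiction λ ¬b → ¬∃ (x , ¬b)

    ≉0⇒Ord : ∀ {x} → ¬ x ≈ int (+ 0) → ∃[ v ] Ord v x
    ≉0⇒Ord {x} x≉0 with ¬∀⇒∃¬ (λ h → x≉0 (Ord≥-all⇒≈0 {x} h))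
    ... | k , ¬d with ¬Ord≥⇒Ord {x} k ¬d
    ...   | v , _ , o = v , o

    -- Orders add under multiplication, so the product of the nonzero elements `z` and `x - y` would
    -- have a finite order and be nonzero.
    ⊛-cancel : ∀ {x y z} → ¬ z ≈ int (+ 0) → z ⊛ x ≈ z ⊛ y → x ≈ y
    ⊛-cancel {x} {y} {z} z≉0 e = by-contradiction contra
      where
      distrib : ∀ z x y → z * x - z * y ≡ z * (x - y)
      distrib = solve-∀
      contra : ¬ ¬ x ≈ y
      contra x≉y with ≉0⇒Ord {z} z≉0 | ≉0⇒Ord {x ⊖ y} (λ h → x≉y (⊖≈0⇒≈ {x} {y} h))
      ... | v , oz | w , od = Ord⇒≉0 {z ⊛ (x ⊖ y)} (Ord-* {z} {x ⊖ y} oz od)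
        (λ n → ∣-resp-≡ (ℤP.+-identityʳ _)
          (∣-resp-≡ (sym (distrib (residue z n) (residue x n) (residue y n))) (e n)))

-- Spans of finitely many integer sequences

span-mono : ∀ {S T : Pred Seq 0ℓ} → S ⊆ ⟨ T ⟩ → ⟨ S ⟩ ⊆ ⟨ T ⟩
span-mono S⊆T (generator x) = S⊆T x
span-mono S⊆T zeroˢ = zeroˢ
span-mono S⊆T (addˢ x y) = addˢ (span-mono S⊆T x) (span-mono S⊆T y)
span-mono S⊆T (scaleˢ m x) = scaleˢ m (span-mono S⊆T x)
span-mono S⊆T (respˢ e x) = respˢ e (span-mono S⊆T x)

span-sub : ∀ {S : Pred Seq 0ℓ} {s t} m → ⟨ S ⟩ s → ⟨ S ⟩ t → ⟨ S ⟩ (λ n → s n - m * t n)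
span-sub {s = s} {t} m x y =
  respˢ (λ n → cong (λ x → s n + x) (sym (ℤP.neg-distribˡ-* m (t n)))) (addˢ x (scaleˢ (- m) y))

span-[] : ∀ {s} → ⟨ _∈ [] ⟩ s → ∀ n → s n ≡ + 0
span-[] zeroˢ n = refl
span-[] (addˢ x y) n = cong₂ _+_ (span-[] x n) (span-[] y n)
span-[] (scaleˢ m x) n = trans (cong (m *_) (span-[] x n)) (ℤP.*-zeroʳ m)
span-[] (respˢ e x) n = trans (sym (e n)) (span-[] x n)

span-reindex : ∀ {gs s} (h : ℕ → ℕ) → ⟨ _∈ gs ⟩ s → ⟨ _∈ map (_∘ h) gs ⟩ (s ∘ h)
span-reindex h (generator x) = generator (∈-map⁺ (_∘ h) x)
span-reindex h zeroˢ = zeroˢ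
span-reindex h (addˢ x y) = addˢ (span-reindex h x) (span-reindex h y)
span-reindex h (scaleˢ m x) = scaleˢ m (span-reindex h x)
span-reindex h (respˢ e x) = respˢ (e ∘ h) (span-reindex h x)

-- The coefficient `c` is read off the derivation; for dependent generators it is not determined by
-- `s`.
split-head : ∀ {g gs s} → ⟨ _∈ (g ∷ gs) ⟩ s → ∃[ c ] ⟨ _∈ gs ⟩ (λ n → s n - c * g n)
split-head {g} (generator (here refl)) = + 1 , respˢ (λ n → eq (g n)) zeroˢ
  where
  eq : ∀ x → + 0 ≡ x - + 1 * x
  eq = solve-∀
split-head {g} (generator {s} (there x)) = + 0 , respˢ (λ n → eq (s n) (g n)) (generator x)
  where
  eq : ∀ x y → x ≡ x - + 0 * y
  eq = solve-∀
split-head {g} zeroˢ = + 0 , respˢ (λ n → eq (g n)) zeroˢ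
  where
  eq : ∀ y → + 0 ≡ + 0 - + 0 * y
  eq = solve-∀
split-head {g} (addˢ {s} {t} x y) with split-head x | split-head y
... | c , x′ | d , y′ = c + d , respˢ (λ n → eq (s n) (t n) c d (g n)) (addˢ x′ y′)
  where
  eq : ∀ s t c d g → (s - c * g) + (t - d * g) ≡ (s + t) - (c + d) * g
  eq = solve-∀
split-head {g} (scaleˢ m {s} x) with split-head x
... | c , x′ = m * c , respˢ (λ n → eq m (s n) c (g n)) (scaleˢ m x′)
  where
  eq : ∀ m s c g → m * (s - c * g) ≡ m * s - (m * c) * g
  eq = solve-∀
split-head {g} (respˢ e x) with split-head x
... | c , x′ = c , respˢ (λ n → cong (_- c * g n) (e n)) x′

-- Containment in a finitely generated module passes to subsets and finite unions, so a kernel can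
-- be treated piece by piece. Finite generation of the span is recovered afterwards by
-- `submodule-fg`.
Covered : Pred Seq 0ℓ → Set
Covered Q = ∃[ gs ] Q ⊆ ⟨ _∈ gs ⟩

covered-∪ : ∀ {Q R} → Covered Q → Covered R → Covered (Q ∪ R)
covered-∪ (gs , Q⊆) (hs , R⊆) = gs ++ hs , λ
  { (inj₁ x) → span-mono (generator ∘ ∈-++⁺ˡ) (Q⊆ x)
  ; (inj₂ y) → span-mono (generator ∘ ∈-++⁺ʳ gs) (R⊆ y) }

covered-⊆ : ∀ {Q R : Pred Seq 0ℓ} → Q ⊆ R → Covered R → Covered Q
covered-⊆ Q⊆R (gs , R⊆) = gs , λ x → R⊆ (Q⊆R x)

covered-⋃ : ∀ {W} (Q : Fin W → Pred Seq 0ℓ) → (∀ κ → Covered (Q κ)) → Covered (λ s → ∃[ κ ] Q κ s)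
covered-⋃ {zero} Q h = [] , λ { (() , _) }
covered-⋃ {suc W} Q h = covered-⊆
  (λ { (Fin.zero , x) → inj₁ x ; (Fin.suc κ , x) → inj₂ (κ , x) })
  (covered-∪ (h Fin.zero) (covered-⋃ (Q ∘ Fin.suc) (h ∘ Fin.suc)))

covered-⋃< : ∀ W (Q : ℕ → Pred Seq 0ℓ) → (∀ m → Covered (Q m)) →
             Covered (λ s → ∃[ m ] m < W × Q m s)
covered-⋃< W Q h = covered-⊆
  (λ { {s} (m , m<W , x) → fromℕ< m<W , subst (λ k → Q k s) (sym (FinP.toℕ-fromℕ< m<W)) x })
  (covered-⋃ {W} (λ κ → Q (toℕ κ)) (λ κ → h (toℕ κ)))

-- Every coefficient matters only modulo `q`, so each further generator multiplies the number of
-- classes by `q`. `combine` and `remQuot` encode the pair of a head residue and a class of the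
-- remaining part.
span-classes : ∀ gs q .{{_ : NonZero q}} → ∃[ W ] Σ[ rep ∈ (Fin W → Seq) ]
  (∀ {s} → ⟨ _∈ gs ⟩ s → ∃[ κ ] ∀ n → + q ∣ s n - rep κ n)
span-classes [] q = 1 , (λ _ _ → + 0) , λ x → Fin.zero , λ n →
  ∣-resp-≡ (cong (_- + 0) (span-[] x n)) (divides (+ 0) refl)
span-classes (g ∷ gs) q with span-classes gs q
... | W , rep , classify = q ℕ.* W , rep′ , classify′
  where
  rep′ : Fin (q ℕ.* W) → Seq
  rep′ κ n = + toℕ (proj₁ (remQuot {q} W κ)) * g n + rep (proj₂ (remQuot {q} W κ)) n
  eq : ∀ s g rep c r t Q → c ≡ r + t * Q →
       s - (r * g + rep) ≡ ((s - c * g) - rep) + (t * g) * Q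
  eq s g rep _ r t Q refl = lemma s g rep r t Q
    where
    lemma : ∀ s g rep r t Q → s - (r * g + rep) ≡ ((s - (r + t * Q) * g) - rep) + (t * g) * Q
    lemma = solve-∀
  classify′ : ∀ {s} → ⟨ _∈ (g ∷ gs) ⟩ s → ∃[ κ ] ∀ n → + q ∣ s n - rep′ κ n
  classify′ {s} x with split-head x
  ... | c , x′ with classify x′
  ...   | κ , h = combine r κ , λ n → ∣-resp-≡
          (trans (cong (λ k → s n - k n) (rep′-combine))
            (eq (s n) (g n) (rep κ n) c (+ toℕ r) (c /ℕ q) (+ q)
              (trans (a≡a%ℕn+[a/ℕn]*n c q)
                (cong (λ k → + k + (c /ℕ q) * + q) (sym (FinP.toℕ-fromℕ< (n%ℕd<d c q)))))))
          (∣m∣n⇒∣m+n (h n) (∣n⇒∣m*n ((c /ℕ q) * g n) ∣-refl))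
    where
    r : Fin q
    r = fromℕ< (n%ℕd<d c q)
    rep′-combine : rep′ (combine r κ) ≡ λ n → + toℕ r * g n + rep κ n
    rep′-combine = cong (λ (rκ : Fin q × Fin W) n → + toℕ (proj₁ rκ) * g n + rep (proj₂ rκ) n) (FinP.remQuot-combine r κ)

-- Modulo q a finitely generated module has finitely many elements.
span-pigeonhole : ∀ gs q .{{_ : NonZero q}} → ∃[ W ] ((b : Fin (suc W) → Seq) →
  (∀ i → ⟨ _∈ gs ⟩ (b i)) → ∃[ i ] ∃[ j ] i Fin.< j × (∀ n → + q ∣ b i n - b j n))
span-pigeonhole gs q with span-classes gs q
... | W , rep , classify = W , λ b b∈ → pick b b∈ (FinP.pigeonhole (ℕP.n<1+n W) (λ i → proj₁ (classify (b∈ i))))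
  where
  eq : ∀ x y r → x - y ≡ (x - r) - (y - r)
  eq = solve-∀
  pick : (b : Fin (suc W) → Seq) (b∈ : ∀ i → ⟨ _∈ gs ⟩ (b i)) →
    (∃[ i ] ∃[ j ] i Fin.< j × proj₁ (classify (b∈ i)) ≡ proj₁ (classify (b∈ j))) →
    ∃[ i ] ∃[ j ] i Fin.< j × (∀ n → + q ∣ b i n - b j n)
  pick b b∈ (i , j , i<j , κ≡) = i , j , i<j , λ n →
    ∣-resp-≡ (eq (b i n) (b j n) (rep (proj₁ (classify (b∈ j))) n))
      (∣m∣n⇒∣m-n (subst (λ κ → + q ∣ b i n - rep κ n) κ≡ (proj₂ (classify (b∈ i)) n))
        (proj₂ (classify (b∈ j)) n))

-- Kernels of progressions and of periodic sequences

-- Dividing `c j + r` by `K = k^i` with quotient `t` and remainder `j′` gives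
-- `c (K n + j) + r = K (c n + t) + j′`. Since `j < K`, the quotient is at most `c + r`, so finitely
-- many substitutions `c n + t` into the given generators suffice.
kernel-progression : ∀ k .{{_ : NonZero k}} a c r → Covered (Kernel k a) →
                     Covered (Kernel k (λ n → a (c ℕ.* n ℕ.+ r)))
kernel-progression k a c r (gs , K⊆) = covered-⊆ to-shift (covered-⋃< (suc (c ℕ.+ r)) Shift covered-shift)
  where
  Shift : ℕ → Pred Seq 0ℓ
  Shift t s = ∃[ u ] ⟨ _∈ gs ⟩ u × (∀ n → u (c ℕ.* n ℕ.+ t) ≡ s n)
  covered-shift : ∀ t → Covered (Shift t)
  covered-shift t = map (_∘ (λ n → c ℕ.* n ℕ.+ t)) gs ,
    λ { (u , u∈ , e) → respˢ e (span-reindex (λ n → c ℕ.* n ℕ.+ t) u∈) }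
  to-shift : Kernel k (λ n → a (c ℕ.* n ℕ.+ r)) ⊆ (λ s → ∃[ t ] t < suc (c ℕ.+ r) × Shift t s)
  to-shift {s} (i , j , j<kⁱ , s≗) =
    t , m<n*o⇒m/o<n {c ℕ.* j ℕ.+ r} {suc (c ℕ.+ r)} {K} bound ,
    (λ n → a (K ℕ.* n ℕ.+ j′)) ,
    K⊆ (i , j′ , m%n<n (c ℕ.* j ℕ.+ r) K , λ _ → refl) ,
    λ n → trans (cong a (index n)) (sym (s≗ n))
    where
    K = k ^ i
    instance
      K-nonZero : NonZero K
      K-nonZero = ℕP.m^n≢0 k i
    t = (c ℕ.* j ℕ.+ r) ℕ./ K
    j′ = (c ℕ.* j ℕ.+ r) ℕ.% K
    bound : c ℕ.* j ℕ.+ r < suc (c ℕ.+ r) ℕ.* K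
    bound = begin-strict
      c ℕ.* j ℕ.+ r           ≤⟨ ℕP.+-mono-≤ (ℕP.*-monoʳ-≤ c (ℕP.<⇒≤ j<kⁱ)) (ℕP.m≤m*n r K) ⟩
      c ℕ.* K ℕ.+ r ℕ.* K     ≡⟨ ℕP.*-distribʳ-+ K c r ⟨
      (c ℕ.+ r) ℕ.* K         <⟨ ℕP.*-monoˡ-< K (ℕP.n<1+n (c ℕ.+ r)) ⟩
      suc (c ℕ.+ r) ℕ.* K     ∎
      where open ℕP.≤-Reasoning
    index : ∀ n → K ℕ.* (c ℕ.* n ℕ.+ t) ℕ.+ j′ ≡ c ℕ.* (K ℕ.* n ℕ.+ j) ℕ.+ r
    index n = begin
      K ℕ.* (c ℕ.* n ℕ.+ t) ℕ.+ j′        ≡⟨ lemma K c n t j′ ⟩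
      c ℕ.* (K ℕ.* n) ℕ.+ (j′ ℕ.+ t ℕ.* K) ≡⟨ cong (c ℕ.* (K ℕ.* n) ℕ.+_) (m≡m%n+[m/n]*n (c ℕ.* j ℕ.+ r) K) ⟨
      c ℕ.* (K ℕ.* n) ℕ.+ (c ℕ.* j ℕ.+ r)  ≡⟨ lemma′ c (K ℕ.* n) j r ⟩
      c ℕ.* (K ℕ.* n ℕ.+ j) ℕ.+ r         ∎
      where
      open ≡-Reasoning
      lemma : ∀ K c n t j → K ℕ.* (c ℕ.* n ℕ.+ t) ℕ.+ j ≡ c ℕ.* (K ℕ.* n) ℕ.+ (j ℕ.+ t ℕ.* K)
      lemma = ℕ-solve-∀
      lemma′ : ∀ c x j r → c ℕ.* x ℕ.+ (c ℕ.* j ℕ.+ r) ≡ c ℕ.* (x ℕ.+ j) ℕ.+ r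
      lemma′ = ℕ-solve-∀

shift-multiple : ∀ {a : Seq} {T} → (∀ n → a (n ℕ.+ T) ≡ a n) → ∀ m n → a (n ℕ.+ m ℕ.* T) ≡ a n
shift-multiple {a} h zero n = cong a (ℕP.+-identityʳ n)
shift-multiple {a} {T} h (suc m) n =
  trans (cong a (sym (ℕP.+-assoc n T (m ℕ.* T)))) (trans (shift-multiple {a} h m (n ℕ.+ T)) (h n))

⟦_⟧ : {A : Set} → Dec A → ℤ
⟦ A? ⟧ = if does A? then + 1 else + 0

⟦⟧-yes : {A : Set} (A? : Dec A) → A → ⟦ A? ⟧ ≡ + 1
⟦⟧-yes (yes _) _ = refl
⟦⟧-yes (no ¬a) a = ⊥-elim (¬a a)

⟦⟧-no : {A : Set} (A? : Dec A) → ¬ A → ⟦ A? ⟧ ≡ + 0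
⟦⟧-no (yes a) ¬a = ⊥-elim (¬a a)
⟦⟧-no (no _) _ = refl

-- The indicators of the residue classes modulo `T` generate; `partial s M` is the part of `s`
-- living on the residues below `M`.
covered-periodic : ∀ T .{{_ : NonZero T}} → Covered (λ s → ∀ n → s (n ℕ.+ T) ≡ s n)
covered-periodic T = applyUpTo indicator T , λ {s} per →
  respˢ (λ n → trans (partial-below s T n (m%n<n n T)) (sym (s-mod per n))) (partial∈ s T ℕP.≤-refl)
  where
  indicator : ℕ → Seq
  indicator t n = ⟦ n ℕ.% T ℕP.≟ t ⟧
  partial : Seq → ℕ → Seq
  partial s zero n = + 0
  partial s (suc M) n = partial s M n + s M * indicator M n
  partial∈ : ∀ s M → M ≤ T → ⟨ _∈ applyUpTo indicator T ⟩ (partial s M)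
  partial∈ s zero _ = zeroˢ
  partial∈ s (suc M) M<T =
    addˢ (partial∈ s M (ℕP.<⇒≤ M<T)) (scaleˢ (s M) (generator (∈-applyUpTo⁺ indicator M<T)))
  partial-above : ∀ s M n → M ≤ n ℕ.% T → partial s M n ≡ + 0
  partial-above s zero n _ = refl
  partial-above s (suc M) n M<r = cong₂ _+_ (partial-above s M n (ℕP.<⇒≤ M<r))
    (trans (cong (s M *_) (⟦⟧-no (n ℕ.% T ℕP.≟ M) (λ r≡M → ℕP.<⇒≢ M<r (sym r≡M)))) (ℤP.*-zeroʳ (s M)))
  partial-below : ∀ s M n → n ℕ.% T < M → partial s M n ≡ s (n ℕ.% T)
  partial-below s (suc M) n (s≤s r≤M) with ℕP.m≤n⇒m<n∨m≡n r≤M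
  ... | inj₂ r≡M = trans (cong₂ _+_ (partial-above s M n (ℕP.≤-reflexive (sym r≡M)))
      (trans (cong (s M *_) (⟦⟧-yes (n ℕ.% T ℕP.≟ M) r≡M)) (ℤP.*-identityʳ (s M))))
    (trans (ℤP.+-identityˡ (s M)) (cong s (sym r≡M)))
  ... | inj₁ r<M = trans (cong₂ _+_ (partial-below s M n r<M)
      (trans (cong (s M *_) (⟦⟧-no (n ℕ.% T ℕP.≟ M) (ℕP.<⇒≢ r<M))) (ℤP.*-zeroʳ (s M))))
    (ℤP.+-identityʳ _)
  s-mod : ∀ {s : Seq} → (∀ n → s (n ℕ.+ T) ≡ s n) → ∀ n → s n ≡ s (n ℕ.% T)
  s-mod {s} per n = trans (cong s (m≡m%n+[m/n]*n n T)) (shift-multiple {s} per (n ℕ./ T) (n ℕ.% T))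

-- A shift of `n` by `T` shifts `k^i n + j` by the multiple `k^i T`, so all kernel elements keep the
-- period `T`.
covered-kernel-periodic : ∀ k a → Periodic a → Covered (Kernel k a)
covered-kernel-periodic k a (T , T>0 , per) = covered-⊆ kernel-periodic
  (covered-periodic T {{ℕ.>-nonZero T>0}})
  where
  index : ∀ K n j T → K ℕ.* (n ℕ.+ T) ℕ.+ j ≡ K ℕ.* n ℕ.+ j ℕ.+ K ℕ.* T
  index = ℕ-solve-∀
  kernel-periodic : Kernel k a ⊆ (λ s → ∀ n → s (n ℕ.+ T) ≡ s n)
  kernel-periodic {s} (i , j , _ , s≗) n = begin
    s (n ℕ.+ T)                                  ≡⟨ s≗ (n ℕ.+ T) ⟩
    a (k ^ i ℕ.* (n ℕ.+ T) ℕ.+ j)                ≡⟨ cong a (index (k ^ i) n j T) ⟩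
    a (k ^ i ℕ.* n ℕ.+ j ℕ.+ k ^ i ℕ.* T)        ≡⟨ shift-multiple {a} per (k ^ i) (k ^ i ℕ.* n ℕ.+ j) ⟩
    a (k ^ i ℕ.* n ℕ.+ j)                        ≡⟨ s≗ n ⟨
    s n                                          ∎
    where open ≡-Reasoning

-- Finite generation of submodules

module _ (em : ExcludedMiddle 0ℓ) where

  least : (Q : ℕ → Set) → ∃ Q → ∃[ d ] Q d × (∀ e → e < d → ¬ Q e)
  least Q (n , q) = go n n ℕP.≤-refl q
    where
    go : ∀ b n → n ≤ b → Q n → ∃[ d ] Q d × (∀ e → e < d → ¬ Q e)
    go b n n≤b q with em {∃[ e ] e < n × Q e}
    ... | no ¬smaller = n , q , λ e e<n q′ → ¬smaller (e , e<n , q′)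
    go zero n n≤b q | yes (e , e<n , q′) = ⊥-elim (ℕP.n≮0 (ℕP.<-≤-trans e<n n≤b))
    go (suc b) n n≤b q | yes (e , e<n , q′) = go b e (ℕP.≤-pred (ℕP.<-≤-trans e<n n≤b)) q′

  -- ℤ is Noetherian: the head coefficients of the elements form an ideal, and
  -- an element with least positive head coefficient generates the module
  -- together with the elements of head coefficient 0.
  submodule-fg : ∀ gs {S : Pred Seq 0ℓ} → S ⊆ ⟨ _∈ gs ⟩ → FinitelyGenerated ⟨ S ⟩
  submodule-fg [] S⊆ = [] , span-mono S⊆ , span-mono (λ ())
  submodule-fg (g ∷ gs) {S} S⊆ = result (em {∃ Leading⁺})
    where
    Leading : ℤ → Set
    Leading c = ∃[ s ] ⟨ S ⟩ s × ⟨ _∈ gs ⟩ (λ n → s n - c * g n)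
    Leading⁺ : ℕ → Set
    Leading⁺ d = Leading (+ suc d)

    result : Dec (∃ Leading⁺) → FinitelyGenerated ⟨ S ⟩
    result (no ¬leading) = submodule-fg gs (λ x → headless x (split-head (S⊆ x)))
      where
      headless : ∀ {s} → S s → ∃[ c ] ⟨ _∈ gs ⟩ (λ n → s n - c * g n) → ⟨ _∈ gs ⟩ s
      headless {s} x (+ zero , y) = respˢ (λ n → eq (s n) (g n)) y
        where
        eq : ∀ x y → x - + 0 * y ≡ x
        eq = solve-∀
      headless {s} x (+ suc c , y) = ⊥-elim (¬leading (c , s , generator x , y))
      -- Head coefficients are closed under negation, so excluding positive ones excludes negative
      -- ones.
      headless {s} x (-[1+ c ] , y) = ⊥-elim (¬leading (c , (λ n → (- + 1) * s n) , scaleˢ (- + 1) (generator x) ,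
        respˢ (λ n → eq (s n) (+ suc c) (g n)) (scaleˢ (- + 1) y)))
        where
        eq : ∀ s c g → (- + 1) * (s - (- c) * g) ≡ (- + 1) * s - c * g
        eq = solve-∀
    result (yes leading) with least Leading⁺ leading
    ... | d , (s₀ , s₀∈S , s₀∈gs) , minimal = s₀ ∷ hs , to , from
      where
      Headless : Pred Seq 0ℓ
      Headless s = ⟨ S ⟩ s × ⟨ _∈ gs ⟩ s
      ih : FinitelyGenerated ⟨ Headless ⟩
      ih = submodule-fg gs {Headless} proj₂
      hs = proj₁ ih
      from : ⟨ _∈ (s₀ ∷ hs) ⟩ ⊆ ⟨ S ⟩
      from = span-mono λ
        { (here refl) → s₀∈S
        ; (there m) → span-mono proj₁ (proj₂ (proj₂ ih) (generator m)) }
      to : ⟨ S ⟩ ⊆ ⟨ _∈ (s₀ ∷ hs) ⟩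
      to {s} x with split-head (span-mono S⊆ x)
      ... | c , y = respˢ (λ n → restore (s n) t (s₀ n))
          (addˢ (span-mono (generator ∘ there) (proj₁ (proj₂ ih) (generator (s′∈S , reduce r r<d y′))))
            (scaleˢ t (generator (here refl))))
        where
        t = c /ℕ suc d
        r = c %ℕ suc d
        r<d : r < suc d
        r<d = n%ℕd<d c (suc d)
        s′ : Seq
        s′ n = s n - t * s₀ n
        s′∈S : ⟨ S ⟩ s′
        s′∈S = span-sub t x s₀∈S
        restore : ∀ s t s₀ → (s - t * s₀) + t * s₀ ≡ s
        restore = solve-∀
        recombine : ∀ s c g t s₀ r D → c ≡ r + t * D →
          (s - c * g) - t * (s₀ - D * g) ≡ (s - t * s₀) - r * g
        recombine s _ g t s₀ r D refl = lemma s g t s₀ r D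
          where
          lemma : ∀ s g t s₀ r D → (s - (r + t * D) * g) - t * (s₀ - D * g) ≡ (s - t * s₀) - r * g
          lemma = solve-∀
        y′ : ⟨ _∈ gs ⟩ (λ n → s′ n - + r * g n)
        y′ = respˢ (λ n → recombine (s n) c (g n) t (s₀ n) (+ r) (+ suc d) (a≡a%ℕn+[a/ℕn]*n c (suc d)))
          (span-sub t y s₀∈gs)
        -- `s′` has head coefficient `r`, the remainder of `c` modulo the least positive head
        -- coefficient; a positive `r` would be smaller still.
        reduce : ∀ r → r < suc d → ⟨ _∈ gs ⟩ (λ n → s′ n - + r * g n) → ⟨ _∈ gs ⟩ s′
        reduce zero _ z = respˢ (λ n → eq (s′ n) (g n)) z
          where
          eq : ∀ x y → x - + 0 * y ≡ x
          eq = solve-∀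
        reduce (suc r) (s≤s r<d) z = ⊥-elim (minimal r r<d (s′ , s′∈S , z))

  covered⇒regular : ∀ {k a} → 2 ≤ k → Covered (Kernel k a) → RegularFor k a
  covered⇒regular 2≤k (gs , K⊆) = 2≤k , submodule-fg gs K⊆

  periodic⇒regular : ∀ {k a} → 2 ≤ k → Periodic a → RegularFor k a
  periodic⇒regular {k} {a} 2≤k per = covered⇒regular {k} {a} 2≤k (covered-kernel-periodic k a per)

regular⇒covered : ∀ {k a} → RegularFor k a → Covered (Kernel k a)
regular⇒covered (_ , gs , K⊆ , _) = gs , λ x → K⊆ (generator x)

-- Integer polynomials and division by a linear factor

eval : List ℤ → ℤ → ℤ
eval [] x = + 0
eval (a ∷ as) x = a + x * eval as x

coef : List ℤ → ℕ → ℤ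
coef [] n = + 0
coef (a ∷ as) zero = a
coef (a ∷ as) (suc n) = coef as n

-- The quotient of the division by X - a.
quot : ℤ → List ℤ → List ℤ
quot a [] = []
quot a (b ∷ bs) = eval bs a ∷ quot a bs

eval-quot : ∀ as x a → eval as x - eval as a ≡ (x - a) * eval (quot a as) x
eval-quot [] x a = sym (ℤP.*-zeroʳ (x - a))
eval-quot (b ∷ bs) x a = step b x a (eval bs x) (eval bs a) (eval (quot a bs) x) (eval-quot bs x a)
  where
  split : ∀ b x a X A → (b + x * X) - (b + a * A) ≡ (x - a) * A + x * (X - A)
  split = solve-∀
  collect : ∀ x a A Q → (x - a) * A + x * ((x - a) * Q) ≡ (x - a) * (A + x * Q)
  collect = solve-∀
  step : ∀ b x a X A Q → X - A ≡ (x - a) * Q → (b + x * X) - (b + a * A) ≡ (x - a) * (A + x * Q)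
  step b x a X A Q e = trans (split b x a X A)
    (trans (cong (λ z → (x - a) * A + x * z) e) (collect x a A Q))

-- The formula of synthetic division. It reduces congruences between quotients to congruences
-- between values of polynomials.
coef-quot : ∀ a as n → coef (quot a as) n ≡ eval (drop (suc n) as) a
coef-quot a [] n = refl
coef-quot a (b ∷ bs) zero = refl
coef-quot a (b ∷ bs) (suc n) = coef-quot a bs n

eval-drop : ∀ as n a → eval (drop n as) a ≡ coef as n + a * eval (drop (suc n) as) a
eval-drop [] zero a = sym (trans (ℤP.+-identityˡ (a * + 0)) (ℤP.*-zeroʳ a))
eval-drop [] (suc n) a = sym (trans (ℤP.+-identityˡ (a * + 0)) (ℤP.*-zeroʳ a))
eval-drop (b ∷ bs) zero a = refl
eval-drop (b ∷ bs) (suc n) a = eval-drop bs n a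

coef-drop : ∀ as n i → coef (drop n as) i ≡ coef as (n ℕ.+ i)
coef-drop as zero i = refl
coef-drop [] (suc n) i = refl
coef-drop (b ∷ bs) (suc n) i = coef-drop bs n i

-- Since `coef` is 0 past the end, lists of different lengths are compared as polynomials.
CoefCong : ℤ → List ℤ → List ℤ → Set
CoefCong d as bs = ∀ n → d ∣ coef as n - coef bs n

coef-∣⇒eval-∣ : ∀ {d} as x → (∀ n → d ∣ coef as n) → d ∣ eval as x
coef-∣⇒eval-∣ [] x h = divides (+ 0) refl
coef-∣⇒eval-∣ (a ∷ as) x h = ∣m∣n⇒∣m+n (h 0) (∣n⇒∣m*n x (coef-∣⇒eval-∣ as x (h ∘ suc)))

eval-cong-∷ : ∀ d a b x y A B → d ∣ a - b → d ∣ x - y → d ∣ A - B → d ∣ (a + x * A) - (b + y * B)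
eval-cong-∷ d a b x y A B d∣a-b d∣x-y d∣A-B = ∣-resp-≡ (split a b x y A B)
  (∣m∣n⇒∣m+n (∣m∣n⇒∣m+n d∣a-b (∣m⇒∣m*n A d∣x-y)) (∣n⇒∣m*n y d∣A-B))
  where
  split : ∀ a b x y A B → (a + x * A) - (b + y * B) ≡ (a - b) + (x - y) * A + y * (A - B)
  split = solve-∀

CoefCong-[]⇒eval-∣ : ∀ {d} as x → CoefCong d as [] → d ∣ eval as x
CoefCong-[]⇒eval-∣ as x h = coef-∣⇒eval-∣ as x λ n → ∣-resp-≡ (sym (ℤP.+-identityʳ (coef as n))) (h n)

eval-cong : ∀ {d} as bs {x y} → CoefCong d as bs → d ∣ x - y → d ∣ eval as x - eval bs y
eval-cong [] bs {x} {y} h _ = ∣-difference-sym (eval bs y) (+ 0)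
  (∣-resp-≡ (ℤP.+-identityʳ (eval bs y))
    (CoefCong-[]⇒eval-∣ bs y λ n → ∣-difference-sym (+ 0) (coef bs n) (h n)))
eval-cong (a ∷ as) [] {x} h _ =
  ∣-resp-≡ (ℤP.+-identityʳ (eval (a ∷ as) x)) (CoefCong-[]⇒eval-∣ (a ∷ as) x h)
eval-cong {d} (a ∷ as) (b ∷ bs) {x} {y} h d∣x-y =
  eval-cong-∷ d a b x y (eval as x) (eval bs y) (h 0) d∣x-y (eval-cong {d} as bs {x} {y} (λ n → h (suc n)) d∣x-y)

drop-cong : ∀ {d} n as bs → CoefCong d as bs → CoefCong d (drop n as) (drop n bs)
drop-cong n as bs h i = ∣-resp-≡ (cong₂ _-_ (coef-drop as n i) (coef-drop bs n i)) (h (n ℕ.+ i))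

quot-cong : ∀ {d} as bs {x y} → CoefCong d as bs → d ∣ x - y → CoefCong d (quot x as) (quot y bs)
quot-cong as bs {x} {y} h d∣x-y n = ∣-resp-≡ (cong₂ _-_ (coef-quot x as n) (coef-quot y bs n))
  (eval-cong (drop (suc n) as) (drop (suc n) bs) (drop-cong (suc n) as bs h) d∣x-y)

bounded-uniform : (R : ℕ → ℕ → Set) → (∀ {d E E′} → E ≤ E′ → R d E → R d E′) →
                  (∀ d → ∃[ E ] R d E) → ∀ m → ∃[ E ] (∀ d → d < m → R d E)
bounded-uniform R mono h zero = 0 , λ _ ()
bounded-uniform R mono h (suc m) with bounded-uniform R mono h m | h m
... | E , below | E′ , at = E ℕ.⊔ E′ , uniform
  where
  uniform : ∀ d → d < suc m → R d (E ℕ.⊔ E′)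
  uniform d (s≤s d≤m) with ℕP.m≤n⇒m<n∨m≡n d≤m
  ... | inj₁ d<m = mono (ℕP.m≤m⊔n E E′) (below d d<m)
  ... | inj₂ refl = mono (ℕP.m≤n⊔m E E′) at

-- Restricted power series and their order near a point

module LocalForms (p : ℕ) (p-prime : Prime p) where

  open Valuation p p-prime

  private instance
    p-nonZero : NonZero p
    p-nonZero = prime⇒nonZero p-prime

  -- An element of the completed ring ℤₚ⟨X⟩, as the inverse limit of the (ℤ/pᴸ)[X].
  record Series : Set where
    field
      poly   : ℕ → List ℤ
      compat : ∀ L → CoefCong (P L) (poly (suc L)) (poly L)

  open Series

  value : Series → Zp → Zp
  value F x = mkℤₚ (λ L → eval (poly F L) (residue x L))
    (λ L → eval-cong (poly F (suc L)) (poly F L) (compat F L) (coherent x L))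

  divide : Series → Zp → Series
  divide F α = record
    { poly = λ L → quot (residue α L) (poly F L)
    ; compat = λ L → quot-cong (poly F (suc L)) (poly F L) (compat F L) (coherent α L)
    }

  value-divide : ∀ F α → value F α ≈ int (+ 0) → ∀ x → value F x ≈ (x ⊖ α) ⊛ value (divide F α) x
  value-divide F α Fα≈0 x n = ∣-resp-≡
    (trans (cong (λ z → X - z) (sym (eval-quot (poly F n) (residue x n) (residue α n)))) (cancel X A))
    (Fα≈0 n)
    where
    X = eval (poly F n) (residue x n)
    A = eval (poly F n) (residue α n)
    cancel : ∀ X A → X - (X - A) ≡ A - + 0
    cancel = solve-∀

  -- Strassmann's condition: modulo p^V the series is a polynomial of degree N.
  HasDegree : Series → ℕ → ℕ → Set
  HasDegree F N V = (∀ n → N < n → P V ∣ coef (poly F V) n) × ¬ P V ∣ coef (poly F V) N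

  drop-∣ : ∀ F {N V} → HasDegree F N V → ∀ n → N < n → ∀ a → P V ∣ eval (drop n (poly F V)) a
  drop-∣ F {V = V} (above , _) n N<n a = coef-∣⇒eval-∣ (drop n (poly F V)) a λ i →
    ∣-resp-≡ (coef-drop (poly F V) n i) (above (n ℕ.+ i) (ℕP.<-≤-trans N<n (ℕP.m≤m+n n i)))

  -- Modulo `p^V` the value at `α` is the constant coefficient, which `p^V` does not divide.
  degree-0⇒no-root : ∀ F {V} → HasDegree F 0 V → ∀ α → ¬ value F α ≈ int (+ 0)
  degree-0⇒no-root F {V} deg α Fα≈0 = proj₂ deg
    (∣m+n∣n⇒∣m {m = coef (poly F V) 0}
      (subst (P V ∣_) (trans (ℤP.+-identityʳ _) (eval-drop (poly F V) 0 (residue α V))) (Fα≈0 V))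
      (∣n⇒∣m*n (residue α V) (drop-∣ F deg 1 (s≤s z≤n) (residue α V))))

  -- Modulo `p^V` coefficient `N` of the quotient equals coefficient `suc N` of `F`, because the
  -- tail above it vanishes. Hence the same `V` serves again.
  degree-divide : ∀ F α {N V} → HasDegree F (suc N) V → HasDegree (divide F α) N V
  degree-divide F α {N} {V} deg =
    (λ n N<n → ∣-resp-≡ (coef-quot a (poly F V) n) (drop-∣ F deg (suc n) (s≤s N<n) a)) ,
    λ d → proj₂ deg (∣m+n∣n⇒∣m {m = coef (poly F V) (suc N)}
      (subst (P V ∣_) (trans (coef-quot a (poly F V) N) (eval-drop (poly F V) (suc N) a)) d)
      (∣n⇒∣m*n a (drop-∣ F deg (suc (suc N)) ℕP.≤-refl a)))
    where
    a = residue α V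

  Near : ℕ → ℤ → Zp → Set
  Near i r x = Ord≥ i (x ⊖ int r)

  ConstantOrder : (Zp → Zp) → ℕ → ℤ → Set
  ConstantOrder F i r = ∃[ c ] (∀ x → Near i r x → Ord c (F x))

  -- For a root `α`, `suc m` is its multiplicity and `c` the constant order on the class of the
  -- cofactor of `(x - α)^(suc m)`.
  RootOrder : (Zp → Zp) → ℕ → ℤ → Zp → Set
  RootOrder F i r α = ∃[ c ] ∃[ m ] (∀ x → Near i r x → ∀ v → Ord v (x ⊖ α) → Ord (c ℕ.+ suc m ℕ.* v) (F x))

  Form : (Zp → Zp) → ℕ → ℤ → Set
  Form F i r = ConstantOrder F i r ⊎ ∃[ α ] Near i r α × F α ≈ int (+ 0) × RootOrder F i r α

  near-self : ∀ α i → Near i (residue α i) α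
  near-self α i = ∣-difference-refl (residue α i)

  near-weaken : ∀ {i i′ r r′} x → i ≤ i′ → P i ∣ r′ - r → Near i′ r′ x → Near i r x
  near-weaken {i} {i′} {r} {r′} x i≤i′ r≡r′ x≡r′ = residue-∣⇒Ord≥ (x ⊖ int r) i≤i′
    (∣-difference-trans (residue x i′) r′ r (∣-trans (P-mono i≤i′) x≡r′) r≡r′)

  -- If the smaller class still contains `α`, the root form is inherited. Otherwise all its points
  -- have the same order `v < i′` of distance from `α`, and the root form becomes a constant order.
  form-refine : ∀ {F i i′ r r′} → i ≤ i′ → P i ∣ r′ - r → Form F i r → Form F i′ r′
  form-refine i≤i′ r≡r′ (inj₁ (c , h)) = inj₁ (c , λ x near → h x (near-weaken x i≤i′ r≡r′ near))
  form-refine {F} {i} {i′} {r} {r′} i≤i′ r≡r′ (inj₂ (α , α-near , Fα≈0 , c , m , h))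
    with P i′ ∣? residue (int r′ ⊖ α) i′
  ... | yes d = inj₂ (α , ∣-difference-sym r′ (residue α i′) d , Fα≈0 , c , m ,
          λ x near → h x (near-weaken x i≤i′ r≡r′ near))
  ... | no ¬d with ¬Ord≥⇒Ord {int r′ ⊖ α} i′ ¬d
  ...   | v , v<i′ , o = inj₁ (c ℕ.+ suc m ℕ.* v , λ x near → h x (near-weaken x i≤i′ r≡r′ near) v
            (Ord-resp-≈ {(int r′ ⊖ α) ⊕ (x ⊖ int r′)} {x ⊖ α} {v}
              (≈-pointwise {(int r′ ⊖ α) ⊕ (x ⊖ int r′)} {x ⊖ α} λ n → swap r′ (residue α n) (residue x n))
              (Ord-⊕ {int r′ ⊖ α} {x ⊖ int r′} o (Ord≥-antitone (x ⊖ int r′) v<i′ near))))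
    where
    swap : ∀ r a x → (r - a) + (x - r) ≡ x - a
    swap = solve-∀

  module _ (em : ExcludedMiddle 0ℓ) where

    -- Each root is divided out in turn; the degree modulo p^V drops every time.
    local-form : ∀ N F V → HasDegree F N V → ∀ α →
      ∃[ M ] (ConstantOrder (value F) M (residue α M) ⊎
              (value F α ≈ int (+ 0) × RootOrder (value F) M (residue α M) α))
    local-form N F V deg α with em {value F α ≈ int (+ 0)}
    local-form zero F V deg α | yes Fα≈0 = ⊥-elim (degree-0⇒no-root F deg α Fα≈0)
    local-form (suc N) F V deg α | yes Fα≈0
      with local-form N (divide F α) V (degree-divide F α deg) α
    -- The quotient does not vanish at `α`, so the root is simple.
    ... | M , inj₁ (c , h) = M , inj₂ (Fα≈0 , c , 0 , λ x near v o →
            Ord-resp-≈ {(x ⊖ α) ⊛ value (divide F α) x} {value F x}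
              (≈-sym {value F x} {(x ⊖ α) ⊛ value (divide F α) x} (value-divide F α Fα≈0 x))
              (subst (λ w → Ord w ((x ⊖ α) ⊛ value (divide F α) x)) (eq v c)
                (Ord-* {x ⊖ α} {value (divide F α) x} o (h x near))))
      where
      eq : ∀ v c → v ℕ.+ c ≡ c ℕ.+ 1 ℕ.* v
      eq = ℕ-solve-∀
    ... | M , inj₂ (_ , c , m , h) = M , inj₂ (Fα≈0 , c , suc m , λ x near v o →
            Ord-resp-≈ {(x ⊖ α) ⊛ value (divide F α) x} {value F x}
              (≈-sym {value F x} {(x ⊖ α) ⊛ value (divide F α) x} (value-divide F α Fα≈0 x))
              (subst (λ w → Ord w ((x ⊖ α) ⊛ value (divide F α) x)) (eq v c (suc m ℕ.* v))
                (Ord-* {x ⊖ α} {value (divide F α) x} o (h x near v o))))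
      where
      eq : ∀ v c w → v ℕ.+ (c ℕ.+ w) ≡ c ℕ.+ (v ℕ.+ w)
      eq = ℕ-solve-∀
    local-form N F V deg α | no Fα≉0 with ≉0⇒Ord em {value F α} Fα≉0
    -- `F` preserves congruences, so `x` congruent to `α` modulo `p^(v+1)` gives `F x` congruent to
    -- `F α` modulo `p^(v+1)`, which is enough to fix the order `v`.
    ... | v , o = suc v , inj₁ (v , λ x near →
            Ord-resp-≈ {value F α ⊕ (value F x ⊖ value F α)} {value F x}
              (≈-pointwise {value F α ⊕ (value F x ⊖ value F α)} {value F x}
                λ n → restore (residue (value F α) n) (residue (value F x) n))
              (Ord-⊕ {value F α} {value F x ⊖ value F α} o
                (eval-cong (poly F (suc v)) (poly F (suc v))
                  (λ n → ∣-difference-refl (coef (poly F (suc v)) n)) near)))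
      where
      restore : ∀ a x → a + (x - a) ≡ x
      restore = solve-∀

    -- Compactness of ℤₚ, by following a bad residue class downwards.
    compactness : (Q : ℕ → ℤ → Set) →
      (∀ {i i′ r r′} → i ≤ i′ → P i ∣ r′ - r → Q i r → Q i′ r′) →
      (∀ α → ∃[ i ] Q i (residue α i)) → ∃[ E ] (∀ r → Q E r)
    compactness Q refine cover = finish (by-contradiction em {Uniform 0 (+ 0)} refute)
      where
      Uniform : ℕ → ℤ → Set
      Uniform i r = ∃[ E ] i ≤ E × (∀ y → P i ∣ y - r → Q E y)

      child : ℕ → ℤ → ℕ → ℤ
      child i r d = r + + d * P i

      join : ∀ i r → (∀ d → Uniform (suc i) (child i r d)) → Uniform i r
      join i r h = E , ℕP.<⇒≤ i<E , λ y y≡r → descend y y≡r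
        where
        R : ℕ → ℕ → Set
        R d E = suc i ≤ E × (∀ y → P (suc i) ∣ y - child i r d → Q E y)
        joined : ∃[ E ] (∀ d → d < p → R d E)
        joined = bounded-uniform R
          (λ E≤E′ (i<E , q) → ℕP.≤-trans i<E E≤E′ ,
            λ y y≡ → refine E≤E′ (∣-difference-refl y) (q y y≡)) h p
        E = proj₁ joined
        i<E : suc i ≤ E
        i<E = proj₁ (proj₂ joined 0 (ℕ.>-nonZero⁻¹ p))
        descend : ∀ y → P i ∣ y - r → Q E y
        -- The last digit `t %ℕ p` of `t = (y - r) / p^i` selects the child class that contains `y`.
        descend y (divides t y-r≡) = proj₂ (proj₂ joined (t %ℕ p) (n%ℕd<d t p)) y
          (divides (t /ℕ p) (begin
            y - child i r (t %ℕ p)               ≡⟨ regroup y r (+ (t %ℕ p)) (P i) ⟩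
            (y - r) - + (t %ℕ p) * P i           ≡⟨ cong (λ z → z - + (t %ℕ p) * P i) y-r≡ ⟩
            t * P i - + (t %ℕ p) * P i           ≡⟨ cong (λ z → z * P i - + (t %ℕ p) * P i) (a≡a%ℕn+[a/ℕn]*n t p) ⟩
            (+ (t %ℕ p) + (t /ℕ p) * + p) * P i - + (t %ℕ p) * P i
                                                 ≡⟨ collect (+ (t %ℕ p)) (t /ℕ p) (+ p) (P i) ⟩
            (t /ℕ p) * (+ p * P i)               ≡⟨ cong ((t /ℕ p) *_) (ℤP.pos-* p (p ^ i)) ⟨
            (t /ℕ p) * P (suc i)                 ∎))
          where
          open ≡-Reasoning
          regroup : ∀ y r D π → y - (r + D * π) ≡ (y - r) - D * π
          regroup = solve-∀
          collect : ∀ D u q π → (D + u * q) * π - D * π ≡ u * (q * π)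
          collect = solve-∀

      Bad : ℕ → Set
      Bad i = ∃[ r ] ¬ Uniform i r

      finish : Uniform 0 (+ 0) → ∃[ E ] (∀ r → Q E r)
      finish (E , _ , h) = E , λ r → h r (Ord≥-0 (int (r - + 0)))

      refute : ¬ ¬ Uniform 0 (+ 0)
      -- The nested bad classes define a point `α`. The cover gives a level `i` at which the class
      -- of `α` satisfies `Q`; by refinement this class is uniform with `E = i`, contrary to the
      -- choice of `bad i`.
      refute ¬u = proj₂ (bad i) (i , ℕP.≤-refl , λ y y≡ → refine ℕP.≤-refl y≡ q)
        where
        next : ∀ i → (b : Bad i) → ∃[ d ] ¬ Uniform (suc i) (child i (proj₁ b) d)
        next i (r , ¬u) = ¬∀⇒∃¬ em (λ h → ¬u (join i r h))
        bad : ∀ i → Bad i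
        bad zero = + 0 , ¬u
        bad (suc i) = child i (proj₁ (bad i)) (proj₁ (next i (bad i))) , proj₂ (next i (bad i))
        α : Zp
        α = mkℤₚ (λ i → proj₁ (bad i)) λ i →
          divides (+ proj₁ (next i (bad i))) (cancel (proj₁ (bad i)) (+ proj₁ (next i (bad i)) * P i))
          where
          cancel : ∀ r z → r + z - r ≡ z
          cancel = solve-∀
        i = proj₁ (cover α)
        q = proj₂ (cover α)

    uniform-form : ∀ F {N V} → HasDegree F N V → ∃[ E ] (∀ r → Form (value F) E r)
    uniform-form F {N} {V} deg = compactness (Form (value F)) (form-refine {value F}) λ α →
      at α (local-form N F V deg α)
      where
      at : ∀ α → ∃[ M ] (ConstantOrder (value F) M (residue α M) ⊎
              (value F α ≈ int (+ 0) × RootOrder (value F) M (residue α M) α)) →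
           ∃[ M ] Form (value F) M (residue α M)
      at α (M , inj₁ h) = M , inj₁ h
      at α (M , inj₂ (Fα≈0 , h)) = M , inj₂ (α , near-self α M , Fα≈0 , h)

-- Partial sums in Horner form

coef-applyUpTo-< : ∀ (g : ℕ → ℤ) {n N} → n < N → coef (applyUpTo g N) n ≡ g n
coef-applyUpTo-< g {zero} (s≤s _) = refl
coef-applyUpTo-< g {suc n} (s≤s n<N) = coef-applyUpTo-< (g ∘ suc) n<N

coef-applyUpTo-≥ : ∀ (g : ℕ → ℤ) {n N} → N ≤ n → coef (applyUpTo g N) n ≡ + 0
coef-applyUpTo-≥ g z≤n = refl
coef-applyUpTo-≥ g (s≤s N≤n) = coef-applyUpTo-≥ (g ∘ suc) N≤n

eval-snoc-1 : ∀ (g : ℕ → ℤ) N → eval (applyUpTo g (suc N)) (+ 1) ≡ eval (applyUpTo g N) (+ 1) + g N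
eval-snoc-1 g zero = eq (g 0)
  where
  eq : ∀ a → a + + 1 * + 0 ≡ + 0 + a
  eq = solve-∀
eval-snoc-1 g (suc N) = trans (cong (λ z → g 0 + + 1 * z) (eval-snoc-1 (g ∘ suc) N))
  (eq (g 0) (eval (applyUpTo (g ∘ suc) N) (+ 1)) (g (suc N)))
  where
  eq : ∀ a e b → a + + 1 * (e + b) ≡ (a + + 1 * e) + b
  eq = solve-∀

module Horner {B : Set} (_⊕_ _⊛_ : B → B → B) (𝟘 : B) where

  opaque
    horner : (ℕ → B) → B → ℕ → B
    horner C x zero = 𝟘
    horner C x (suc N) = C 0 ⊕ (x ⊛ horner (λ i → C (suc i)) x N)

    horner-zero : ∀ C x → horner C x zero ≡ 𝟘
    horner-zero C x = refl

    horner-suc : ∀ C x N → horner C x (suc N) ≡ C 0 ⊕ (x ⊛ horner (λ i → C (suc i)) x N)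
    horner-suc C x N = refl

-- Generic in the semiring: comparing concrete p-adic sums by unfolding is infeasible.
module PartialSums (A : RawSemiring 0ℓ 0ℓ) {B : Set} (_≈ᴮ_ : B → B → Set) (_⊕_ _⊛_ : B → B → B) (𝟘 𝟙 : B)
  (e : B → RawSemiring.Carrier A) (R : RawSemiring.Carrier A → B → Set) where

  open RawSemiring A using (Carrier; 0#; 1#) renaming (_+_ to _+ᴬ_; _*_ to _*ᴬ_)
  open RawSemiringDefinitions A using (sum) renaming (_^_ to _^ᴬ_)

  open Horner _⊕_ _⊛_ 𝟘

  partialSum : (ℕ → Carrier) → B → ℕ → Carrier
  partialSum c x N = sum {N} (λ i → c (toℕ i) *ᴬ e x ^ᴬ toℕ i)

  record Laws : Set where
    field
      e-1        : 1# ≡ e 𝟙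
      e-*        : ∀ x y → e x *ᴬ e y ≡ e (x ⊛ y)
      zeroʳ      : ∀ y → 𝟘 ≈ᴮ (y ⊛ 𝟘)
      factors    : ∀ c y x z → ((c ⊛ (y ⊛ 𝟙)) ⊕ ((y ⊛ x) ⊛ z)) ≈ᴮ (y ⊛ (c ⊕ (x ⊛ z)))
      associates : ∀ c y x z → (c ⊛ (y ⊛ (x ⊛ z))) ≈ᴮ (c ⊛ ((y ⊛ x) ⊛ z))
      identity   : ∀ z → (𝟙 ⊛ z) ≈ᴮ z
      identity′  : ∀ c z → (c ⊛ z) ≈ᴮ (c ⊛ (𝟙 ⊛ z))
      R-resp     : ∀ a z z′ → z ≈ᴮ z′ → R a z → R a z′
      R-0        : R 0# 𝟘
      R-+        : ∀ a a′ z z′ → R a z → R a′ z′ → R (a +ᴬ a′) (z ⊕ z′)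
      R-*        : ∀ a z x → R a z → R (a *ᴬ e x) (z ⊛ x)

  module _ (laws : Laws) where

    open Laws laws

    pow : B → ℕ → B
    pow x zero = 𝟙
    pow x (suc i) = x ⊛ pow x i

    e-^ : ∀ x i → e x ^ᴬ i ≡ e (pow x i)
    e-^ x zero = e-1
    e-^ x (suc i) = trans (cong (e x *ᴬ_) (e-^ x i)) (e-* x (pow x i))

    -- The terms after the first carry one more factor `x`. The accumulator `y` collects these
    -- factors, so that the induction hypothesis applies to the shifted coefficients.
    sum-horner : ∀ N (t : ℕ → Carrier) C x y → (∀ i → i < N → R (t i) (C i ⊛ (y ⊛ pow x i))) →
      R (sum {N} (λ i → t (toℕ i))) (y ⊛ horner C x N)
    sum-horner zero t C x y h = subst (λ z → R 0# (y ⊛ z)) (sym (horner-zero C x)) (R-resp 0# 𝟘 (y ⊛ 𝟘) (zeroʳ y) R-0)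
    sum-horner (suc N) t C x y h = subst (λ z → R (t 0 +ᴬ s) (y ⊛ z)) (sym (horner-suc C x N))
      (R-resp _ _ _ (factors (C 0) y x (horner (λ i → C (suc i)) x N))
        (R-+ (t 0) s _ _ (h 0 (s≤s z≤n)) (sum-horner N (λ i → t (suc i)) (λ i → C (suc i)) x (y ⊛ x) λ i i<N →
          R-resp _ _ _ (associates (C (suc i)) y x (pow x i)) (h (suc i) (s≤s i<N)))))
      where
      s : Carrier
      s = sum {N} (λ i → t (suc (toℕ i)))

    partialSum-horner : ∀ c C x N → (∀ n → n < N → R (c n) (C n)) → R (partialSum c x N) (horner C x N)
    partialSum-horner c C x N h = R-resp _ _ _ (identity (horner C x N))
      (sum-horner N (λ i → c i *ᴬ e x ^ᴬ i) C x 𝟙 λ i i<N → R-resp _ _ _ (identity′ (C i) (pow x i))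
        (subst (λ z → R (c i *ᴬ z) (C i ⊛ pow x i)) (sym (e-^ x i)) (R-* (c i) (C i) (pow x i) (h i i<N))))

-- Units, denominators and limits in the p-adic numbers

module PadicNumbers (p : ℕ) (p-prime : Prime p) where

  open Valuation p p-prime
  open LocalForms p p-prime

  private instance
    p-nonZero : NonZero p
    p-nonZero = prime⇒nonZero p-prime

  open RawRing (ℚₚ-rawRing p) using () renaming (_≈_ to _≈ᵠ_; _+_ to _+ᵠ_; _*_ to _*ᵠ_; -_ to -ᵠ_; 0# to 0ᵠ)
  open ℚₚ

  inverse-mod-p : ∀ a → ¬ P 1 ∣ a → ∃[ b ] P 1 ∣ + 1 - a * b
  inverse-mod-p a ¬d = signed (ℤP.+∣i∣≡i⊎+∣i∣≡-i a) (nat-inverse (coprime-Bézout coprime))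
    where
    coprime : Coprime ℤ.∣ a ∣ p
    coprime (d∣a , d∣p) with prime⇒irreducible p-prime d∣p
    ... | inj₁ d≡1 = d≡1
    ... | inj₂ refl = ⊥-elim (¬d (∣ᵤ⇒∣ (subst (ℕD._∣ ℤ.∣ a ∣) (sym (ℕP.*-identityʳ p)) d∣a)))
    P1≡ : + p ≡ P 1
    P1≡ = cong +_ (sym (ℕP.*-identityʳ p))
    cast : ∀ x y m n → 1 ℕ.+ y ℕ.* n ≡ x ℕ.* m → + 1 + + y * + n ≡ + x * + m
    cast x y m n e = trans (cong (λ z → + 1 + z) (sym (ℤP.pos-* y n)))
      (trans (cong +_ e) (ℤP.pos-* x m))
    nat-inverse : Bézout.Identity 1 ℤ.∣ a ∣ p → ∃[ b ] P 1 ∣ + 1 - + ℤ.∣ a ∣ * b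
    nat-inverse (Bézout.+- x y e) = + x , divides (- + y)
      (trans (eq (+ ℤ.∣ a ∣) (+ x) (+ y) (+ p) (cast x y ℤ.∣ a ∣ p e)) (cong (- + y *_) P1≡))
      where
      lemma : ∀ y q z → + 1 - (+ 1 + y * q) ≡ - y * q
      lemma = solve-∀
      eq : ∀ A x y q → + 1 + y * q ≡ x * A → + 1 - A * x ≡ - y * q
      eq A x y q e = trans (cong (λ z → + 1 - z) (trans (ℤP.*-comm A x) (sym e))) (lemma y q A)
    nat-inverse (Bézout.-+ x y e) = - + x , divides (+ y)
      (trans (eq (+ ℤ.∣ a ∣) (+ x)) (trans (cast y x p ℤ.∣ a ∣ e) (cong (+ y *_) P1≡)))
      where
      eq : ∀ A x → + 1 - A * - x ≡ + 1 + x * A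
      eq = solve-∀
    signed : (+ ℤ.∣ a ∣ ≡ a ⊎ + ℤ.∣ a ∣ ≡ - a) → (∃[ b ] P 1 ∣ + 1 - + ℤ.∣ a ∣ * b) → ∃[ b ] P 1 ∣ + 1 - a * b
    signed (inj₁ e) (b , d) = b , subst (λ z → P 1 ∣ + 1 - z * b) e d
    signed (inj₂ e) (b , d) = - b , ∣-resp-≡ (eq a b) (subst (λ z → P 1 ∣ + 1 - z * b) e d)
      where
      eq : ∀ a b → + 1 - a * - b ≡ + 1 - - a * b
      eq = solve-∀

  -- With `b₁` an inverse modulo `p`, the error `1 - a b` of `b` is corrected by `b₁ (1 - a b)`; the
  -- new error is the product of the errors of `b` and `b₁`, which gains one power of `p`.
  inverse-mod : ∀ a → ¬ P 1 ∣ a → ∀ n → ∃[ b ] P n ∣ + 1 - a * b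
  inverse-mod a ¬d zero = + 0 , divides (+ 1 - a * + 0) (sym (ℤP.*-identityʳ _))
  inverse-mod a ¬d (suc n) with inverse-mod a ¬d n | inverse-mod-p a ¬d
  ... | b , divides s s≡ | b₁ , divides t t≡ = b + b₁ * (+ 1 - a * b) , divides (s * t)
    (trans (factor a b b₁) (trans (cong₂ _*_ s≡ t≡) (trans (swap s (P n) t (P 1))
      (cong (s * t *_) (trans (sym (P-+ n 1)) (cong P (ℕP.+-comm n 1)))))))
    where
    factor : ∀ a b b₁ → + 1 - a * (b + b₁ * (+ 1 - a * b)) ≡ (+ 1 - a * b) * (+ 1 - a * b₁)
    factor = solve-∀
    swap : ∀ a b c d → (a * b) * (c * d) ≡ (a * c) * (b * d)
    swap = solve-∀

  -- The residue at index 0 carries no information, so the inverse is assembled from the residues at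
  -- index `suc n`. Its coherence is the uniqueness of inverses modulo `p^n`.
  unit-inverse : ∀ u → (∀ n → ¬ P 1 ∣ residue u (suc n)) → IsUnit p u
  unit-inverse u ¬d = mkℤₚ b coh , inverse
    where
    b : ℕ → ℤ
    b n = proj₁ (inverse-mod (residue u (suc n)) (¬d n) (suc n))
    b-inverse : ∀ n → P (suc n) ∣ + 1 - residue u (suc n) * b n
    b-inverse n = proj₂ (inverse-mod (residue u (suc n)) (¬d n) (suc n))
    coh : ∀ n → P n ∣ b (suc n) - b n
    coh n = ∣-resp-≡ (eq (b (suc n)) (b n) (residue u (suc (suc n))) (residue u (suc n)))
      (∣m∣n⇒∣m-n
        (∣m∣n⇒∣m-n (∣n⇒∣m*n (b (suc n)) (∣-trans (P-mono (ℕP.n≤1+n n)) (b-inverse n)))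
          (∣n⇒∣m*n (b n) (∣-trans (P-mono (ℕP.m≤n+m n 2)) (b-inverse (suc n)))))
        (∣n⇒∣m*n (b n * b (suc n)) (∣-trans (P-mono (ℕP.n≤1+n n)) (coherent u (suc n)))))
      where
      eq : ∀ b′ b u′ u → b′ - b ≡ b′ * (+ 1 - u * b) - b * (+ 1 - u′ * b′) - (b * b′) * (u′ - u)
      eq = solve-∀
    inverse : u ⊛ mkℤₚ b coh ≈ int (+ 1)
    inverse n = ∣-resp-≡ (eq (residue u n) (residue u (suc n)) (b n))
      (∣m⇒∣-m (∣m∣n⇒∣m+n (∣-trans (P-mono (ℕP.n≤1+n n)) (b-inverse n)) (∣m⇒∣m*n (b n) (coherent u n))))
      where
      eq : ∀ u u′ b → u * b - + 1 ≡ - ((+ 1 - u′ * b) + (u′ - u) * b)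
      eq = solve-∀

  -- Division by `p^w` costs `w` digits, so the `n`-th residue of the quotient comes from the
  -- residue of `z` at index `n + w`.
  divide-P : ∀ w z → Ord≥ w z → ∃[ y ] z ≈ int (P w) ⊛ y
  divide-P w z d = y , λ n →
    subst (λ t → P n ∣ residue z n - t) (trans (quotient≡ n) (ℤP.*-comm (q n) (P w)))
      (∣-difference-sym (residue z (n ℕ.+ w)) (residue z n) (coherent-≤ z (ℕP.m≤m+n n w)))
    where
    q : ℕ → ℤ
    q n = quotient (Ord≥⇒residue-∣ z (ℕP.m≤n+m w n) d)
    quotient≡ : ∀ n → residue z (n ℕ.+ w) ≡ q n * P w
    quotient≡ n = _∣_.equality (Ord≥⇒residue-∣ z (ℕP.m≤n+m w n) d)
    y : Zp
    y = mkℤₚ q λ n → P-cancel w n (subst₂ _∣_ (cong P (ℕP.+-comm n w))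
      (trans (cong₂ _-_ (quotient≡ (suc n)) (quotient≡ n)) (eq (q (suc n)) (q n) (P w)))
      (coherent z (n ℕ.+ w)))
      where
      eq : ∀ a b c → a * c - b * c ≡ c * (a - b)
      eq = solve-∀

  unit-part : ∀ {z w} → Ord w z → ∃[ u ] IsUnit p u × z ≈ int (P w) ⊛ u
  unit-part {z} {w} (d , ¬d) = u , unit-inverse u nonzero , z≈
    where
    u : Zp
    u = proj₁ (divide-P w z d)
    z≈ : z ≈ int (P w) ⊛ u
    z≈ = proj₂ (divide-P w z d)
    nonzero : ∀ n → ¬ P 1 ∣ residue u (suc n)
    nonzero n h = ¬d (Ord≥-resp-≈ {int (P w) ⊛ u} {z} (suc w) (≈-sym {z} {int (P w) ⊛ u} z≈)
      (subst (_∣ P w * residue u (suc w)) (cong P (ℕP.+-comm w 1))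
        (P-∣-* w 1 (Ord≥⇒residue-∣ u (s≤s z≤n) (residue-∣⇒Ord≥ u (s≤s z≤n) h)))))

  P-⊛-cancel : ∀ k x y → int (P k) ⊛ x ≈ int (P k) ⊛ y → x ≈ y
  P-⊛-cancel k x y h n = ∣-transfer (residue x n - residue y n) (residue x (k ℕ.+ n) - residue y (k ℕ.+ n))
    (∣-resp-≡ (eq (residue x n) (residue y n) (residue x (k ℕ.+ n)) (residue y (k ℕ.+ n)))
      (∣m∣n⇒∣m-n (coherent-≤ y (ℕP.m≤n+m n k)) (coherent-≤ x (ℕP.m≤n+m n k))))
    (P-cancel k n (∣-resp-≡ (eq′ (P k) (residue x (k ℕ.+ n)) (residue y (k ℕ.+ n))) (h (k ℕ.+ n))))
    where
    eq : ∀ a b c d → (a - b) - (c - d) ≡ (d - b) - (c - a)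
    eq = solve-∀
    eq′ : ∀ k a b → k * (a - b) ≡ k * a - k * b
    eq′ = solve-∀

  -- `y = z / p^K` with the denominator fixed in advance: questions about sums and limits of p-adic
  -- numbers become congruences between p-adic integers.
  record Rep (K : ℕ) (y : ℚₚ p) (z : Zp) : Set where
    constructor cleared
    field
      equation : y ≈ᵠ (z /p^ K)

  open Rep

  Rep-resp : ∀ {K} y {z z′} → z ≈ z′ → Rep K y z → Rep K y z′
  Rep-resp {K} (a /p^ e) {z} {z′} z≈z′ (cleared h) = cleared λ n → ∣-resp-≡
    (eq (P K) (residue a n) (P e) (residue z n) (residue z′ n))
    (∣m∣n⇒∣m+n (h n) (∣n⇒∣m*n (P e) (z≈z′ n)))
    where
    eq : ∀ K a e z z′ → K * a - e * z′ ≡ (K * a - e * z) + e * (z - z′)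
    eq = solve-∀

  Rep-unique : ∀ {K} y {z z′} → Rep K y z → Rep K y z′ → z ≈ z′
  Rep-unique {K} (a /p^ e) {z} {z′} (cleared h) (cleared h′) = P-⊛-cancel e z z′ λ n → ∣-resp-≡
    (eq (P K) (residue a n) (P e) (residue z n) (residue z′ n)) (∣m∣n⇒∣m-n (h′ n) (h n))
    where
    eq : ∀ K a e z z′ → e * z - e * z′ ≡ (K * a - e * z′) - (K * a - e * z)
    eq = solve-∀

  Rep-0 : ∀ K → Rep K 0ᵠ (int (+ 0))
  Rep-0 K = cleared λ n → ∣-resp-≡ (eq (P K)) (divides (+ 0) refl)
    where
    eq : ∀ K → K * + 0 - + 1 * + 0 ≡ + 0
    eq = solve-∀

  Rep-+ : ∀ {K} y y′ {z z′} → Rep K y z → Rep K y′ z′ → Rep K (y +ᵠ y′) (z ⊕ z′)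
  Rep-+ {K} (a /p^ e) (a′ /p^ e′) {z} {z′} (cleared h) (cleared h′) = cleared λ n → ∣-resp-≡
    (trans (cong (λ E → P K * (P e′ * residue a n + P e * residue a′ n) - E * (residue z n + residue z′ n)) (P-+ e e′))
      (eq (P K) (residue a n) (residue a′ n) (P e) (P e′) (residue z n) (residue z′ n)))
    (∣m∣n⇒∣m+n (∣n⇒∣m*n (P e′) (h n)) (∣n⇒∣m*n (P e) (h′ n)))
    where
    eq : ∀ K a a′ e e′ z z′ → K * (e′ * a + e * a′) - (e * e′) * (z + z′) ≡
         e′ * (K * a - e * z) + e * (K * a′ - e′ * z′)
    eq = solve-∀

  Rep-*ι : ∀ {K} y {z} x → Rep K y z → Rep K (y *ᵠ ι p x) (z ⊛ x)
  Rep-*ι {K} (a /p^ e) {z} x (cleared h) = cleared λ n → ∣-resp-≡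
    (trans (cong (λ E → P K * (residue a n * residue x n) - P E * (residue z n * residue x n)) (ℕP.+-identityʳ e))
      (eq (P K) (residue a n) (P e) (residue z n) (residue x n)))
    (∣m⇒∣m*n (residue x n) (h n))
    where
    eq : ∀ K a e z x → K * (a * x) - e * (z * x) ≡ (K * a - e * z) * x
    eq = solve-∀

  Rep-at : ∀ K y → exponent y ≤ K → Rep K y (int (P (K ℕ.∸ exponent y)) ⊛ numerator y)
  Rep-at K (a /p^ e) e≤K = cleared λ n → ∣-resp-≡
    (trans (cong (λ E → E * residue a n - P e * (P (K ℕ.∸ e) * residue a n))
        (trans (cong P (sym (ℕP.m+[n∸m]≡n e≤K))) (P-+ e (K ℕ.∸ e))))
      (eq (P e) (P (K ℕ.∸ e)) (residue a n)))
    (divides (+ 0) refl)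
    where
    eq : ∀ e d a → (e * d) * a - e * (d * a) ≡ + 0
    eq = solve-∀

  Rep-raise : ∀ K y {z} → Rep 0 y z → Rep K y (int (P K) ⊛ z)
  Rep-raise K (a /p^ e) {z} (cleared h) = cleared λ n → ∣-resp-≡ (eq (P K) (residue a n) (P e) (residue z n)) (∣n⇒∣m*n (P K) (h n))
    where
    eq : ∀ K a e z → K * a - e * (K * z) ≡ K * (+ 1 * a - e * z)
    eq = solve-∀

  Rep-exists : ∀ K y → exponent y ≤ K → ∃[ z ] Rep K y z
  Rep-exists K y e≤K = int (P (K ℕ.∸ exponent y)) ⊛ numerator y , Rep-at K y e≤K

  Rep-raise-∃ : ∀ K y {u} → ∃[ w ] Rep 0 y (u ⊛ w) → ∃[ z ] Rep K y z
  Rep-raise-∃ K y {u} (w , h) = int (P K) ⊛ (u ⊛ w) , Rep-raise K y {u ⊛ w} h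

  Rep-lower : ∀ K y {z} → Rep K y (int (P K) ⊛ z) → Rep 0 y z
  Rep-lower K (a /p^ e) {z} (cleared h) = cleared (P-⊛-cancel K (int (+ 1) ⊛ a) (int (P e) ⊛ z) λ n →
    ∣-resp-≡ (eq (P K) (residue a n) (P e) (residue z n)) (h n))
    where
    eq : ∀ K a e z → K * (+ 1 * a) - K * (e * z) ≡ K * a - e * (K * z)
    eq = solve-∀

  Rep-0⇒≈0 : ∀ K y {z} → Rep K y z → z ≈ int (+ 0) → y ≈ᵠ 0ᵠ
  Rep-0⇒≈0 K y {z} h z≈0 = equation (Rep-lower K y {int (+ 0)} (Rep-resp y {z} {int (P K) ⊛ int (+ 0)}
    (λ n → subst (λ t → P n ∣ residue z n - t) (sym (ℤP.*-zeroʳ (P K))) (z≈0 n)) h))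

  ≈0⇒Rep-0 : ∀ K y {z} → Rep K y z → y ≈ᵠ 0ᵠ → z ≈ int (+ 0)
  ≈0⇒Rep-0 K y {z} h y≈0 = Rep-unique y h (Rep-resp y {int (P K) ⊛ int (+ 0)} {int (+ 0)}
    (≈-pointwise {int (P K) ⊛ int (+ 0)} {int (+ 0)} λ n → ℤP.*-zeroʳ (P K)) (Rep-raise K y {int (+ 0)} (cleared y≈0)))

  Rep⇒nonnegative-valuation : ∀ K d y {z u} → Rep K y z → z ≈ int (P (K ℕ.+ d)) ⊛ u → y ≈ᵠ ι p (int (P d)) *ᵠ ι p u
  Rep⇒nonnegative-valuation K d (a /p^ e) {z} {u} (cleared h) z≈ = P-⊛-cancel K (int (+ 1) ⊛ a) (int (P e) ⊛ (int (P d) ⊛ u)) λ n → ∣-resp-≡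
    (eq (P K) (P d) (residue a n) (P e) (residue u n) (residue z n) (P (K ℕ.+ d)) (P-+ K d))
    (∣m∣n⇒∣m+n (h n) (∣n⇒∣m*n (P e) (z≈ n)))
    where
    lemma : ∀ k d a e u z → k * (+ 1 * a) - k * (e * (d * u)) ≡ (k * a - e * z) + e * (z - (k * d) * u)
    lemma = solve-∀
    eq : ∀ k d a e u z w → w ≡ k * d → k * (+ 1 * a) - k * (e * (d * u)) ≡ (k * a - e * z) + e * (z - w * u)
    eq k d a e u z _ refl = lemma k d a e u z

  Rep⇒negative-valuation : ∀ w d y {z u} → Rep (w ℕ.+ suc d) y z → z ≈ int (P w) ⊛ u →
    y ≈ᵠ (int (+ 1) /p^ suc d) *ᵠ ι p u
  Rep⇒negative-valuation w d (a /p^ e) {z} {u} (cleared h) z≈ = P-⊛-cancel w (int (P (suc d ℕ.+ 0)) ⊛ a) (int (P e) ⊛ (int (+ 1) ⊛ u)) λ n → ∣-resp-≡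
    (trans (cong (λ E → P w * (P E * residue a n) - P w * (P e * (+ 1 * residue u n))) (ℕP.+-identityʳ (suc d)))
      (eq (P w) (P (suc d)) (residue a n) (P e) (residue u n) (residue z n) (P (w ℕ.+ suc d)) (P-+ w (suc d))))
    (∣m∣n⇒∣m+n (h n) (∣n⇒∣m*n (P e) (z≈ n)))
    where
    lemma : ∀ w d a e u z → w * (d * a) - w * (e * (+ 1 * u)) ≡ ((w * d) * a - e * z) + e * (z - w * u)
    lemma = solve-∀
    eq : ∀ w d a e u z K → K ≡ w * d → w * (d * a) - w * (e * (+ 1 * u)) ≡ (K * a - e * z) + e * (z - w * u)
    eq w d a e u z _ refl = lemma w d a e u z

  -- The cases follow the sign of `w - K`, on which the definition of `p^ℤ` depends.
  Rep⇒HasValuation : ∀ K y {z w} → Rep K y z → Ord w z → HasValuation p y (+ w - + K)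
  Rep⇒HasValuation K y {z} {w} h o = by-sign (ℕP.<-≤-connex w K)
    where
    u = proj₁ (unit-part {z} {w} o)
    unit : IsUnit p u
    unit = proj₁ (proj₂ (unit-part {z} {w} o))
    z≈ : z ≈ int (P w) ⊛ u
    z≈ = proj₂ (proj₂ (unit-part {z} {w} o))
    cancel⁺ : ∀ k d → + (k ℕ.+ d) - + k ≡ + d
    cancel⁺ k d = trans (cong (λ t → t - + k) (ℤP.pos-+ k d)) (eq (+ k) (+ d))
      where
      eq : ∀ k d → (k + d) - k ≡ d
      eq = solve-∀
    cancel⁻ : ∀ w d → + w - + (w ℕ.+ d) ≡ - + d
    cancel⁻ w d = trans (cong (λ t → + w - t) (ℤP.pos-+ w d)) (eq (+ w) (+ d))
      where
      eq : ∀ w d → w - (w + d) ≡ - d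
      eq = solve-∀
    nonnegative : ∀ {w} d → K ℕ.+ d ≡ w → z ≈ int (P w) ⊛ u → HasValuation p y (+ w - + K)
    nonnegative d refl z≈ = subst (HasValuation p y) (sym (cancel⁺ K d))
      (u , unit , Rep⇒nonnegative-valuation K d y {z} {u} h z≈)
    negative : ∀ {K} d → w ℕ.+ suc d ≡ K → Rep K y z → HasValuation p y (+ w - + K)
    negative d refl h = subst (HasValuation p y) (sym (cancel⁻ w (suc d)))
      (u , unit , Rep⇒negative-valuation w d y {z} {u} h z≈)
    by-sign : w < K ⊎ K ≤ w → HasValuation p y (+ w - + K)
    by-sign (inj₁ w<K) = negative (K ℕ.∸ suc w) (trans (ℕP.+-suc w _) (ℕP.m+[n∸m]≡n w<K)) h
    by-sign (inj₂ K≤w) = nonnegative (w ℕ.∸ K) (ℕP.m+[n∸m]≡n K≤w) z≈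

  open Horner _⊕_ _⊛_ (int (+ 0)) public

  residue-horner : ∀ C x N L →
    residue (horner C x N) L ≡ eval (applyUpTo (λ n → residue (C n) L) N) (residue x L)
  residue-horner C x zero L = cong (λ z → residue z L) (horner-zero C x)
  residue-horner C x (suc N) L = trans (cong (λ z → residue z L) (horner-suc C x N))
    (cong (λ z → residue (C 0) L + residue x L * z) (residue-horner (λ i → C (suc i)) x N L))

  private module Sums K = PartialSums (RawRing.rawSemiring (ℚₚ-rawRing p)) _≈_ _⊕_ _⊛_ (int (+ 0)) (int (+ 1)) (ι p) (Rep K)

  opaque
    partialSum : (ℕ → ℚₚ p) → Zp → ℕ → ℚₚ p
    partialSum = Sums.partialSum 0

    partialSum-≡ : ∀ c x → partialSum c x ≡ (λ N → RawSemiringDefinitions.sum (RawRing.rawSemiring (ℚₚ-rawRing p)) {N}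
      (λ i → c (toℕ i) *ᵠ RawSemiringDefinitions._^_ (RawRing.rawSemiring (ℚₚ-rawRing p)) (ι p x) (toℕ i)))
    partialSum-≡ c x = refl

  Rep-laws : ∀ K → Sums.Laws K
  Rep-laws K = record
    { e-1        = refl
    ; e-*        = λ x y → refl
    ; zeroʳ      = λ y → ≈-pointwise {int (+ 0)} {y ⊛ int (+ 0)} λ n → sym (ℤP.*-zeroʳ (residue y n))
    ; factors    = λ c y x z → ≈-pointwise {c ⊛ (y ⊛ int (+ 1)) ⊕ (y ⊛ x) ⊛ z} {y ⊛ (c ⊕ x ⊛ z)} λ n →
                     factors (residue c n) (residue y n) (residue x n) (residue z n)
    ; associates = λ c y x z → ≈-pointwise {c ⊛ (y ⊛ (x ⊛ z))} {c ⊛ ((y ⊛ x) ⊛ z)} λ n →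
                     cong (residue c n *_) (sym (ℤP.*-assoc (residue y n) (residue x n) (residue z n)))
    ; identity   = λ z → ≈-pointwise {int (+ 1) ⊛ z} {z} λ n → ℤP.*-identityˡ (residue z n)
    ; identity′  = λ c z → ≈-pointwise {c ⊛ z} {c ⊛ (int (+ 1) ⊛ z)} λ n →
                     cong (residue c n *_) (sym (ℤP.*-identityˡ (residue z n)))
    ; R-resp     = λ a z z′ → Rep-resp {K} a {z} {z′}
    ; R-0        = Rep-0 K
    ; R-+        = λ a a′ z z′ → Rep-+ {K} a a′ {z} {z′}
    ; R-*        = λ a z x → Rep-*ι {K} a {z} x
    }
    where
    factors : ∀ c y x z → c * (y * + 1) + (y * x) * z ≡ y * (c + x * z)
    factors = solve-∀

  Rep-partialSum : ∀ K c C x N → (∀ n → n < N → Rep K (c n) (C n)) → Rep K (partialSum c x N) (horner C x N)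
  Rep-partialSum K c C x N h = subst (λ s → Rep K (s N) (horner C x N)) (sym (partialSum-≡ c x))
    (Sums.partialSum-horner K (Rep-laws K) c C x N h)

  -- The relation s - y = p^k w, cleared of denominators.
  Rep-difference : ∀ {K} s y {T} k w → Rep K s T → s +ᵠ -ᵠ y ≈ᵠ ι p (p^ p k ⊛ w) →
    int (P (exponent y)) ⊛ T ≈ int (P K) ⊛ numerator y ⊕ int (P (exponent y)) ⊛ (int (P K) ⊛ (int (P k) ⊛ w))
  Rep-difference {K} (b /p^ σ) (a /p^ e) {T} k w (cleared h) d = P-⊛-cancel σ (int (P e) ⊛ T) (int (P K) ⊛ a ⊕ int (P e) ⊛ (int (P K) ⊛ (int (P k) ⊛ w))) λ n →
    ∣-resp-≡ (eq (P K) (P σ) (P e) (residue b n) (residue a n) (residue T n) (P k * residue w n))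
      (∣m∣n⇒∣m-n (∣n⇒∣m*n (P K)
          (subst (λ E → P n ∣ + 1 * (P e * residue b n + P σ * - residue a n) - E * (P k * residue w n)) (P-+ σ e) (d n)))
        (∣n⇒∣m*n (P e) (h n)))
    where
    eq : ∀ K σ e b a T w → σ * (e * T) - σ * (K * a + e * (K * w)) ≡
      K * (+ 1 * (e * b + σ * - a) - (σ * e) * w) - e * (K * b - σ * T)
    eq = solve-∀

  horner-snoc-1 : ∀ C N → horner C (int (+ 1)) (suc N) ≈ horner C (int (+ 1)) N ⊕ C N
  horner-snoc-1 C N = ≈-pointwise {horner C (int (+ 1)) (suc N)} {horner C (int (+ 1)) N ⊕ C N} λ n →
    trans (residue-horner C (int (+ 1)) (suc N) n)
      (trans (eval-snoc-1 (λ i → residue (C i) n) N)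
        (cong (_+ residue (C N) n) (sym (residue-horner C (int (+ 1)) N n))))

  cancel-difference : ∀ e K k {T T′ t a w w′} → T′ ≈ T ⊕ t →
    int (P e) ⊛ T ≈ int (P K) ⊛ a ⊕ int (P e) ⊛ (int (P K) ⊛ (int (P k) ⊛ w)) →
    int (P e) ⊛ T′ ≈ int (P K) ⊛ a ⊕ int (P e) ⊛ (int (P K) ⊛ (int (P k) ⊛ w′)) →
    t ≈ int (P K) ⊛ (int (P k) ⊛ (w′ ⊖ w))
  cancel-difference e K k {T} {T′} {t} {a} {w} {w′} snoc h h′ = P-⊛-cancel e t (int (P K) ⊛ (int (P k) ⊛ (w′ ⊖ w))) λ n → ∣-resp-≡
    (eq (P e) (residue T n) (residue t n) (residue T′ n) (P K * residue a n) (P K) (P k) (residue w n) (residue w′ n))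
    (∣m∣n⇒∣m-n (∣m∣n⇒∣m-n (h′ n) (h n)) (∣n⇒∣m*n (P e) (snoc n)))
    where
    eq : ∀ e T C T′ a K k w w′ → e * C - e * (K * (k * (w′ - w))) ≡
      ((e * T′ - (a + e * (K * (k * w′)))) - (e * T - (a + e * (K * (k * w))))) - e * (T′ - (T + C))
    eq = solve-∀

  Close : ℚₚ p → ℚₚ p → ℕ → Set
  Close s y k = ∃[ w ] s +ᵠ -ᵠ y ≈ᵠ ι p (p^ p k ⊛ w)

  Rep-last-term : ∀ {K T T′ Z} s s′ y t k → T′ ≈ T ⊕ Z → Rep K s T → Rep K s′ T′ → Rep K t Z →
    Close s y k → Close s′ y k → ∃[ w ] Rep 0 t (int (P k) ⊛ w)
  Rep-last-term {K} {T} {T′} {Z} s s′ y t k snoc rep rep′ rep-t (w , d) (w′ , d′) =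
    w′ ⊖ w , Rep-lower K t {int (P k) ⊛ (w′ ⊖ w)}
      (Rep-resp {K} t {Z} {int (P K) ⊛ (int (P k) ⊛ (w′ ⊖ w))}
        (cancel-difference (exponent y) K k {T} {T′} {Z} {numerator y} {w} {w′} snoc
          (Rep-difference {K} s y {T} k w rep d) (Rep-difference {K} s′ y {T′} k w′ rep′ d′))
        rep-t)

  -- The terms of a convergent series are differences of partial sums, hence tend to 0. No common
  -- denominator of all coefficients is available yet, so each `N` has its own exponent `K N`.
  terms-small : ∀ (s : ℕ → ℚₚ p) y (t : ℕ → ℚₚ p) → ConvergesTo p s y → (K : ℕ → ℕ) (T T′ Z : ℕ → Zp) →
    (∀ N → T′ N ≈ T N ⊕ Z N) → (∀ N → Rep (K N) (s N) (T N)) → (∀ N → Rep (K N) (s (suc N)) (T′ N)) →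
    (∀ N → Rep (K N) (t N) (Z N)) →
    ∀ k → ∃[ N₀ ] ∀ N → N₀ ≤ N → ∃[ w ] Rep 0 (t N) (int (P k) ⊛ w)
  terms-small s y t converges K T T′ Z snoc rep rep′ rep-t k =
    proj₁ (converges k) , λ N N₀≤N →
      Rep-last-term {K N} {T N} {T′ N} {Z N} (s N) (s (suc N)) y (t N) k (snoc N) (rep N) (rep′ N) (rep-t N)
        (proj₂ (converges k) N N₀≤N) (proj₂ (converges k) (suc N) (ℕP.m≤n⇒m≤1+n N₀≤N))

  close-approximation : ∀ {K} s y (z : Zp) {T} L → Rep K s T → P L ∣ residue T L - residue z L → Close s y L →
    P L ∣ P K * residue (numerator y) L - P (exponent y) * residue z L
  close-approximation {K} s y z {T} L rep T≡z (w , d) = ∣-resp-≡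
    (eq (P K * residue (numerator y) L) (P (exponent y)) (residue z L) (residue T L) (P K) (P L) (residue w L))
    (∣m∣n⇒∣m-n
      (∣m∣n⇒∣m-n (∣n⇒∣m*n (P (exponent y)) T≡z) (Rep-difference {K} s y {T} L w rep d L))
      (∣m⇒∣m*n (P (exponent y) * (P K * residue w L)) ∣-refl))
    where
    eq : ∀ a e z T K π w → a - e * z ≡ (e * (T - z) - (e * T - (a + e * (K * (π * w))))) - π * (e * (K * w))
    eq = solve-∀

  -- The equality is checked residue by residue: for index `L`, one member of the sequence beyond
  -- both thresholds decides.
  Rep-limit : ∀ {K} (s : ℕ → ℚₚ p) y z → ConvergesTo p s y → (N₁ : ℕ → ℕ) (T : ℕ → Zp) → (∀ N → Rep K (s N) (T N)) →
    (∀ L N → N₁ L ≤ N → P L ∣ residue (T N) L - residue z L) → Rep K y z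
  Rep-limit {K} s y z converges N₁ T rep T≡z = cleared λ L →
    close-approximation {K} (s (N L)) y z {T (N L)} L (rep (N L)) (T≡z L (N L) (ℕP.m≤n⊔m (N₀ L) (N₁ L)))
      (proj₂ (converges L) (N L) (ℕP.m≤m⊔n (N₀ L) (N₁ L)))
    where
    N₀ N : ℕ → ℕ
    N₀ L = proj₁ (converges L)
    N L = N₀ L ℕ.⊔ N₁ L

  -- The restricted power series of an analytic function

  module PowerSeries (c : ℕ → ℚₚ p) (f : Zp → ℚₚ p)
    (converges : ∀ x → ConvergesTo p (partialSum c x) (f x)) where

    denominators : ∀ N → ∃[ K ] (∀ n → n < N → exponent (c n) ≤ K)
    denominators = bounded-uniform (λ n K → exponent (c n) ≤ K) (λ K≤K′ h → ℕP.≤-trans h K≤K′)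
      (λ n → exponent (c n) , ℕP.≤-refl)

    -- Convergence is used at the point 1, where the terms of the series are the coefficients
    -- themselves.
    coefficient-small : ∀ k → ∃[ N₀ ] ∀ N → N₀ ≤ N → ∃[ w ] Rep 0 (c N) (int (P k) ⊛ w)
    coefficient-small = terms-small (partialSum c (int (+ 1))) (f (int (+ 1))) c (converges (int (+ 1)))
      K (λ N → horner (C N) (int (+ 1)) N) (λ N → horner (C N) (int (+ 1)) (suc N)) (λ N → C N N)
      (λ N → horner-snoc-1 (C N) N)
      (λ N → Rep-partialSum (K N) c (C N) (int (+ 1)) N (λ n n<N → rep N n (ℕP.m<n⇒m<1+n n<N)))
      (λ N → Rep-partialSum (K N) c (C N) (int (+ 1)) (suc N) (rep N))
      (λ N → rep N N (ℕP.n<1+n N))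
      where
      K : ℕ → ℕ
      K N = proj₁ (denominators (suc N))
      C : ℕ → ℕ → Zp
      C N n = int (P (K N ℕ.∸ exponent (c n))) ⊛ numerator (c n)
      rep : ∀ N n → n < suc N → Rep (K N) (c n) (C N n)
      rep N n n≤N = Rep-at (K N) (c n) (proj₂ (denominators (suc N)) n n≤N)

    opaque
      N₀ : ℕ
      N₀ = proj₁ (coefficient-small 0)

      integral : ∀ n → N₀ ≤ n → ∃[ w ] Rep 0 (c n) (int (P 0) ⊛ w)
      integral = proj₂ (coefficient-small 0)

      -- From `N₀` on the coefficients are integral, so a bound for the finitely many earlier
      -- exponents gives a common denominator of all coefficients.
      K : ℕ
      K = proj₁ (denominators N₀)

      exponent≤K : ∀ n → n < N₀ → exponent (c n) ≤ K
      exponent≤K = proj₂ (denominators N₀)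

      scaled : ∀ n → ∃[ z ] Rep K (c n) z
      scaled n = by-size (ℕP.<-≤-connex n N₀)
        where
        by-size : n < N₀ ⊎ N₀ ≤ n → ∃[ z ] Rep K (c n) z
        by-size (inj₁ n<N₀) = Rep-exists K (c n) (exponent≤K n n<N₀)
        by-size (inj₂ N₀≤n) = Rep-raise-∃ K (c n) {int (P 0)} (integral n N₀≤n)

      C : ℕ → Zp
      C n = proj₁ (scaled n)

      C-rep : ∀ n → Rep K (c n) (C n)
      C-rep n = proj₂ (scaled n)

      D : ℕ → ℕ
      D L = proj₁ (coefficient-small L)

      C-small : ∀ L n → D L ≤ n → Ord≥ L (C n)
      C-small L n D≤n = divisible (C n) (C-rep n) (proj₂ (coefficient-small L) n D≤n)
        where
        divisible : ∀ z → Rep K (c n) z → ∃[ w ] Rep 0 (c n) (int (P L) ⊛ w) → Ord≥ L z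
        divisible z rep (w , rep₀) = Ord≥-resp-≈ {int (P K) ⊛ (int (P L) ⊛ w)} {z} L
          (Rep-unique {K} (c n) {int (P K) ⊛ (int (P L) ⊛ w)} {z} (Rep-raise K (c n) {int (P L) ⊛ w} rep₀) rep)
          (∣n⇒∣m*n (P K) (∣m⇒∣m*n (residue w L) ∣-refl))

    truncated : ℕ → ℕ → List ℤ
    truncated L N = applyUpTo (λ n → residue (C n) L) N

    truncated-coef : ∀ L N → D L ≤ N → ∀ n → P L ∣ coef (truncated L N) n - residue (C n) L
    truncated-coef L N D≤N n with ℕP.<-≤-connex n N
    ... | inj₁ n<N = ∣-resp-≡ (cong (_- residue (C n) L) (coef-applyUpTo-< (λ n → residue (C n) L) n<N))
          (∣-difference-refl (residue (C n) L))
    ... | inj₂ N≤n = ∣-resp-≡ (trans (cong (_- residue (C n) L) (coef-applyUpTo-≥ (λ n → residue (C n) L) N≤n))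
            (ℤP.+-identityˡ _))
          (∣m⇒∣-m (C-small L n (ℕP.≤-trans D≤N N≤n)))

    -- From index `D L` on the scaled coefficients vanish modulo `p^L`, so truncation there is the
    -- full reduction modulo `p^L`.
    series : Series
    series = record
      { poly = λ L → truncated L (D L)
      ; compat = λ L n → ∣-difference-trans (coef (truncated (suc L) (D (suc L))) n) (residue (C n) (suc L)) (coef (truncated L (D L)) n)
          (∣-trans (P-mono (ℕP.n≤1+n L)) (truncated-coef (suc L) (D (suc L)) ℕP.≤-refl n))
          (∣-difference-trans (residue (C n) (suc L)) (residue (C n) L) (coef (truncated L (D L)) n)
            (coherent (C n) L)
            (∣-difference-sym (coef (truncated L (D L)) n) (residue (C n) L) (truncated-coef L (D L) ℕP.≤-refl n)))
      }

    value-rep : ∀ x → Rep K (f x) (value series x)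
    value-rep x = Rep-limit {K} (partialSum c x) (f x) (value series x) (converges x) D (horner C x)
      (λ N → Rep-partialSum K c C x N (λ n _ → C-rep n)) λ L N D≤N →
      ∣-resp-≡ (cong (_- residue (value series x) L) (residue-horner C x N L))
        (eval-cong (truncated L N) (truncated L (D L))
          (λ n → ∣-difference-trans (coef (truncated L N) n) (residue (C n) L) (coef (truncated L (D L)) n)
            (truncated-coef L N D≤N n)
            (∣-difference-sym (coef (truncated L (D L)) n) (residue (C n) L) (truncated-coef L (D L) ℕP.≤-refl n)))
          (∣-difference-refl (residue x L)))

    last-nonzero : ∀ V D → (∀ n → D ≤ n → Ord≥ V (C n)) → ∀ n₀ → ¬ Ord≥ V (C n₀) →
      ∃[ N ] ¬ Ord≥ V (C N) × (∀ n → N < n → Ord≥ V (C n))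
    last-nonzero V zero h n₀ ¬d = ⊥-elim (¬d (h n₀ z≤n))
    last-nonzero V (suc D) h n₀ ¬d with P V ∣? residue (C D) V
    ... | no ¬d′ = D , ¬d′ , h
    ... | yes d = last-nonzero V D (λ n D≤n → above n (ℕP.m≤n⇒m<n∨m≡n D≤n)) n₀ ¬d
      where
      above : ∀ n → D < n ⊎ D ≡ n → Ord≥ V (C n)
      above n (inj₁ D<n) = h n D<n
      above n (inj₂ refl) = d

    coefficients≈0⇒value≈0 : (∀ n → C n ≈ int (+ 0)) → ∀ x → value series x ≈ int (+ 0)
    coefficients≈0⇒value≈0 C≈0 x L = ∣-resp-≡ (ℤP.+-identityʳ (eval (truncated L (D L)) (residue x L)))
      (coef-∣⇒eval-∣ (truncated L (D L)) (residue x L) λ n →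
        ∣-transfer (coef (truncated L (D L)) n) (residue (C n) L) (truncated-coef L (D L) ℕP.≤-refl n)
          (∣-resp-≡ (sym (ℤP.+-identityʳ (residue (C n) L))) (C≈0 n L)))

    degree-at : ∀ V N → ¬ Ord≥ V (C N) → (∀ n → N < n → Ord≥ V (C n)) → HasDegree series N V
    degree-at V N ¬d above =
      (λ n N<n → ∣-transfer (coef (truncated V (D V)) n) (residue (C n) V)
        (truncated-coef V (D V) ℕP.≤-refl n) (above n N<n)) ,
      λ d → ¬d (∣-transfer (residue (C N) V) (coef (truncated V (D V)) N)
        (∣-difference-sym (coef (truncated V (D V)) N) (residue (C N) V)
          (truncated-coef V (D V) ℕP.≤-refl N)) d)

    -- Some coefficient is nonzero, as otherwise `f` would vanish identically. `V` is one more than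
    -- its order, so it survives modulo `p^V`; only finitely many coefficients do, and `N` is the
    -- last of them.
    has-degree : ExcludedMiddle 0ℓ → ¬ IdenticallyZero p f → ∃[ N ] ∃[ V ] HasDegree series N V
    has-degree em f≢0 = N , V , degree-at V N (proj₁ (proj₂ last)) (proj₂ (proj₂ last))
      where
      nonzero : ∃[ n ] ¬ C n ≈ int (+ 0)
      nonzero = ¬∀⇒∃¬ em {B = λ n → C n ≈ int (+ 0)} λ C≈0 → f≢0 λ x →
        Rep-0⇒≈0 K (f x) {value series x} (value-rep x) (coefficients≈0⇒value≈0 C≈0 x)
      order : ∃[ v ] Ord v (C (proj₁ nonzero))
      order = ≉0⇒Ord em {C (proj₁ nonzero)} (proj₂ nonzero)
      V : ℕ
      V = suc (proj₁ order)
      last : ∃[ N ] ¬ Ord≥ V (C N) × (∀ n → N < n → Ord≥ V (C n))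
      last = last-nonzero V (D V) (C-small V) (proj₁ nonzero) (proj₂ (proj₂ order))
      N : ℕ
      N = proj₁ last

-- Progressions near a root and irregularity

^-distribʳ-* : ∀ m n o → (m ℕ.* n) ^ o ≡ m ^ o ℕ.* n ^ o
^-distribʳ-* m n zero = refl
^-distribʳ-* m n (suc o) = trans (cong (m ℕ.* n ℕ.*_) (^-distribʳ-* m n o)) (eq m n (m ^ o) (n ^ o))
  where
  eq : ∀ m n x y → m ℕ.* n ℕ.* (x ℕ.* y) ≡ m ℕ.* x ℕ.* (n ℕ.* y)
  eq = ℕ-solve-∀

pos-linear : ∀ k n j → + (k ℕ.* n ℕ.+ j) ≡ + k * + n + + j
pos-linear k n j = trans (ℤP.pos-+ (k ℕ.* n) j) (cong (_+ + j) (ℤP.pos-* k n))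

cancel-factor : ∀ k a b → k ≢ 0 → + k * (+ a - + b) ≡ + 0 → a ≡ b
cancel-factor k a b k≢0 e with ℤP.i*j≡0⇒i≡0∨j≡0 (+ k) e
... | inj₁ k≡0 = ⊥-elim (k≢0 (ℤP.+-injective k≡0))
... | inj₂ e′ = ℤP.+-injective (ℤP.i-j≡0⇒i≡j (+ a) (+ b) e′)

module Irregularity (em : ExcludedMiddle 0ℓ) (p : ℕ) (p-prime : Prime p) where

  open Valuation p p-prime
  open PadicNumbers p p-prime

  mod-P : ℕ → ℤ → ℕ
  mod-P e a = _%ℕ_ a (p ^ e) {{P-nonZero e}}

  mod-P-< : ∀ e a → mod-P e a < p ^ e
  mod-P-< e a = n%ℕd<d a (p ^ e) {{P-nonZero e}}

  mod-P-∣ : ∀ e a → P e ∣ a - + mod-P e a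
  mod-P-∣ e a = divides (_/ℕ_ a (p ^ e) {{P-nonZero e}})
    (eq a (+ mod-P e a) _ (a≡a%ℕn+[a/ℕn]*n a (p ^ e) {{P-nonZero e}}))
    where
    lemma : ∀ r z → (r + z) - r ≡ z
    lemma = solve-∀
    eq : ∀ a r z → a ≡ r + z → a - r ≡ z
    eq _ r z refl = lemma r z

  solve-congruence : ∀ s κ z M → ¬ P 1 ∣ + κ → P s ∣ z → ∃[ n ] P M ∣ (P s * + κ) * + n - z
  solve-congruence s κ z M ¬d (divides y z≡) with inverse-mod (+ κ) ¬d M
  ... | b , inverse = n , ∣-resp-≡
          (eq (P s) (+ κ) b y (+ n) z z≡)
          (∣m∣n⇒∣m+n (∣n⇒∣m*n (- (P s * y)) inverse)
            (∣n⇒∣m*n (- (P s * + κ)) (mod-P-∣ M (b * y))))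
    where
    n = mod-P M (b * y)
    lemma : ∀ s κ b y n → (s * κ) * n - y * s ≡ (- (s * y)) * (+ 1 - κ * b) + (- (s * κ)) * (b * y - n)
    lemma = solve-∀
    eq : ∀ s κ b y n z → z ≡ y * s → (s * κ) * n - z ≡ (- (s * y)) * (+ 1 - κ * b) + (- (s * κ)) * (b * y - n)
    eq s κ b y n _ refl = lemma s κ b y n

  -- The target is `K n + j` congruent to `β + p^V` modulo `p^(V+1)`, which is at order exactly `V`
  -- from `β`. As `p^s` divides `β - j` and `p^V`, dividing by it leaves a congruence with the
  -- invertible coefficient `κ`.
  progression-attains : ∀ s κ K j β V → K ≡ p ^ s ℕ.* κ → ¬ P 1 ∣ + κ → Ord≥ s (nat j ⊖ β) → s ≤ V →
    ∃[ n ] Ord V (nat (K ℕ.* n ℕ.+ j) ⊖ β)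
  progression-attains s κ K j β V K≡ ¬d near s≤V = n ,
    Exact⇒Ord (nat (K ℕ.* n ℕ.+ j) ⊖ β) (ℕP.n<1+n V)
      ( ∣-transfer X (P V) (∣-trans (P-mono (ℕP.n≤1+n V)) close) ∣-refl
      , λ d → proj₂ (Ord-P V) (∣-transfer (P V) X (∣-difference-sym X (P V) close) d))
    where
    b = residue β (suc V)
    z = (b - + j) + P V
    s∣z : P s ∣ z
    s∣z = ∣m∣n⇒∣m+n (∣-difference-sym (+ j) b (Ord≥⇒residue-∣ (nat j ⊖ β) (ℕP.m≤n⇒m≤1+n s≤V) near)) (P-mono s≤V)
    solution : ∃[ n ] P (suc V) ∣ (P s * + κ) * + n - z
    solution = solve-congruence s κ z (suc V) ¬d s∣z
    n = proj₁ solution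
    X = + (K ℕ.* n ℕ.+ j) - b
    eq : ∀ k n j b v → ((k * n + j) - b) - v ≡ k * n - ((b - j) + v)
    eq = solve-∀
    close : P (suc V) ∣ X - P V
    close = ∣-resp-≡ (trans
        (cong (λ t → t - b - P V) (trans (pos-linear K n j)
          (cong (λ t → t * + n + + j) (trans (cong +_ K≡) (ℤP.pos-* (p ^ s) κ)))))
        (eq (P s * + κ) (+ n) (+ j) b (P V)))
      (proj₂ solution)

  -- The fraction may be unreduced and its denominator negative, as it comes out of linear
  -- equations.
  Rational′ : Zp → Set
  Rational′ x = ∃[ d ] ∃[ u ] d ≢ + 0 × int d ⊛ x ≈ int u

  int-≉0 : ∀ {d} → d ≢ + 0 → ¬ int d ≈ int (+ 0)
  int-≉0 d≢0 d≈0 = d≢0 (int-injective d≈0)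

  ¬P1∣-^ : ∀ κ i → ¬ P 1 ∣ + κ → ¬ P 1 ∣ + (κ ^ i)
  ¬P1∣-^ κ zero ¬d = ¬P1∣1
  ¬P1∣-^ κ (suc i) ¬d d with euclid (+ κ) (+ (κ ^ i)) (subst (P 1 ∣_) (ℤP.pos-* κ (κ ^ i)) d)
  ... | inj₁ d′ = ¬d d′
  ... | inj₂ d′ = ¬P1∣-^ κ i ¬d d′

  module _ {b : Seq} {β : Zp} {φ : ℕ → ℤ} {l M : ℕ}
    (φ-quasiperiodic : ∀ v → φ (v ℕ.+ l) ≡ φ v + + suc M)
    (peak : ∀ n v → Ord v (nat n ⊖ β) → b n ≡ φ v) where

    -- If A = K′ (β - j) - K (β - j′) were nonzero, then for n with K n + j close
    -- to β the value b (K′ n + j′) would be fixed by the order of A, while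
    -- b (K n + j) runs through all φ V with V large.
    progressions-agree : ∀ s κ K K′ j j′ → K ≡ p ^ s ℕ.* κ → ¬ P 1 ∣ + κ → Ord≥ s (nat j ⊖ β) →
      (∀ n → + suc (suc M) ∣ b (K ℕ.* n ℕ.+ j) - b (K′ ℕ.* n ℕ.+ j′)) →
      nat K′ ⊛ (β ⊖ nat j) ≈ nat K ⊛ (β ⊖ nat j′)
    progressions-agree s κ K K′ j j′ K≡ ¬d near agree =
      by-contradiction em λ unequal → absurd (≉0⇒Ord em {A} (λ A≈0 → unequal (⊖≈0⇒≈ {nat K′ ⊛ (β ⊖ nat j)} {nat K ⊛ (β ⊖ nat j′)} A≈0)))
      where
      A = nat K′ ⊛ (β ⊖ nat j) ⊖ nat K ⊛ (β ⊖ nat j′)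
      K-order : Ord s (nat K)
      K-order = (divides (+ κ) K≡′) , λ d → ¬d (P-cancel s 1
          (subst₂ _∣_ (cong P (ℕP.+-comm 1 s)) (trans K≡′ (ℤP.*-comm (+ κ) (P s))) d))
        where
        K≡′ : + K ≡ + κ * P s
        K≡′ = trans (cong +_ (trans K≡ (ℕP.*-comm (p ^ s) κ))) (ℤP.pos-* κ (p ^ s))
      absurd : ¬ (∃[ a ] Ord a A)
      -- Modulo `M + 2` both `φ V` and `φ (V + l)` are congruent to `φ (a - s)`, yet they differ by
      -- `M + 1`.
      absurd (a , A-order) = ℕP.<⇒≱ (ℕP.n<1+n (suc M)) (ℕD.∣⇒≤ (∣⇒∣ᵤ
          (∣-resp-≡ {b = (φ (V ℕ.+ l) - φ (a ℕ.∸ s)) - (φ V - φ (a ℕ.∸ s))}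
            (eq (φ (V ℕ.+ l)) (φ V) (φ (a ℕ.∸ s)) (+ suc M) (φ-quasiperiodic V))
            (∣m∣n⇒∣m-n (fixed (V ℕ.+ l) (ℕP.m≤m+n V l)) (fixed V ℕP.≤-refl)))))
        where
        -- `V >= s` makes all orders from `V` on attainable along `K n + j`; `V > a` makes `A` the
        -- dominant term of `A + K′ x`.
        V = s ℕ.+ suc a
        lemma : ∀ x c m → m ≡ ((x + m) - c) - (x - c)
        lemma = solve-∀
        eq : ∀ y x c m → y ≡ x + m → m ≡ (y - c) - (x - c)
        eq _ x c m refl = lemma x c m
        module _ (V′ : ℕ) (V≤V′ : V ≤ V′) where
          hit : ∃[ n ] Ord V′ (nat (K ℕ.* n ℕ.+ j) ⊖ β)
          hit = progression-attains s κ K j β V′ K≡ ¬d near (ℕP.≤-trans (ℕP.m≤m+n s (suc a)) V≤V′)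
          n = proj₁ hit
          x = nat (K ℕ.* n ℕ.+ j) ⊖ β
          y = nat (K′ ℕ.* n ℕ.+ j′) ⊖ β
          -- With `x` and `y` the distances of the two progressions from `β`, `K y = A + K′ x` has
          -- order `a`; as `K` has order `s`, the order of `y` is `a - s` whatever `V′` is.
          Ky≈ : A ⊕ nat K′ ⊛ x ≈ nat K ⊛ y
          Ky≈ = ≈-pointwise {A ⊕ nat K′ ⊛ x} {nat K ⊛ y} λ i →
            trans (cong (λ t → residue A i + + K′ * (t - residue β i)) (pos-linear K n j))
              (trans (expand (+ K′) (residue β i) (+ j) (+ K) (+ j′) (+ n))
                (cong (λ t → + K * (t - residue β i)) (sym (pos-linear K′ n j′))))
            where
            expand : ∀ K′ β j K j′ n → (K′ * (β - j) - K * (β - j′)) + K′ * ((K * n + j) - β) ≡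
              K * ((K′ * n + j′) - β)
            expand = solve-∀
          Ky-order : Ord a (nat K ⊛ y)
          Ky-order = Ord-resp-≈ {A ⊕ nat K′ ⊛ x} {nat K ⊛ y} Ky≈ (Ord-⊕ {A} {nat K′ ⊛ x} A-order
            (∣n⇒∣m*n (+ K′) (Ord≥-antitone x (ℕP.≤-trans (ℕP.m≤n+m (suc a) s) V≤V′) (proj₁ (proj₂ hit)))))
          y≉0 : ¬ y ≈ int (+ 0)
          y≉0 y≈0 = Ord⇒≉0 {nat K ⊛ y} Ky-order λ i → ∣m⇒∣m-n-0 i
            where
            ∣m⇒∣m-n-0 : ∀ i → P i ∣ + K * residue y i - + 0
            ∣m⇒∣m-n-0 i = ∣-resp-≡ (eq′ (+ K) (residue y i)) (∣n⇒∣m*n (+ K) (y≈0 i))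
              where
              eq′ : ∀ k y → k * y - + 0 ≡ k * (y - + 0)
              eq′ = solve-∀
          y-order : ∃[ g ] Ord g y
          y-order = ≉0⇒Ord em {y} y≉0
          g≡ : proj₁ y-order ≡ a ℕ.∸ s
          g≡ = trans (sym (ℕP.m+n∸m≡n s (proj₁ y-order))) (cong (ℕ._∸ s)
            (Ord-unique {nat K ⊛ y} (Ord-* {nat K} {y} K-order (proj₂ y-order)) Ky-order))
          fixed : + suc (suc M) ∣ φ V′ - φ (a ℕ.∸ s)
          fixed = ∣-resp-≡ (cong₂ _-_ (sym (peak (K ℕ.* n ℕ.+ j) V′ (proj₂ hit)))
              (sym (trans (peak (K′ ℕ.* n ℕ.+ j′) (proj₁ y-order) (proj₂ y-order)) (cong φ g≡))))
            (agree n)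

    -- `j i` is the only offset at level `i` congruent to `β` modulo `p^(ti)`. Agreement of two
    -- levels gives `(K′ - K) β = K′ j - K j′` with `K < K′`.
    power-case : ∀ t → 1 ≤ t → Covered (Kernel (p ^ t) b) → Rational′ β
    power-case t 1≤t (gs , K⊆) = from-repetition
        (proj₂ (span-pigeonhole gs (suc (suc M))) (λ i → elt (toℕ i)) (λ i → K⊆ (elt∈ (toℕ i))))
      where
      W : ℕ
      W = proj₁ (span-pigeonhole gs (suc (suc M)))
      j : ℕ → ℕ
      j i = mod-P (t ℕ.* i) (residue β (t ℕ.* i))
      k^i≡ : ∀ i → (p ^ t) ^ i ≡ p ^ (t ℕ.* i)
      k^i≡ i = ℕP.^-*-assoc p t i
      elt : ℕ → Seq
      elt i n = b ((p ^ t) ^ i ℕ.* n ℕ.+ j i)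
      elt∈ : ∀ i → Kernel (p ^ t) b (elt i)
      elt∈ i = i , j i , ℕP.<-≤-trans (mod-P-< (t ℕ.* i) (residue β (t ℕ.* i))) (ℕP.≤-reflexive (sym (k^i≡ i))) , λ _ → refl
      from-repetition : (Σ[ i ∈ Fin (suc W) ] Σ[ i′ ∈ Fin (suc W) ] i Fin.< i′ × (∀ n → + suc (suc M) ∣ elt (toℕ i) n - elt (toℕ i′) n)) → Rational′ β
      from-repetition (i , i′ , i<i′ , agree) =
        + K′ - + K , + K′ * + j (toℕ i) - + K * + j (toℕ i′) ,
        (λ K′-K≡0 → ℕP.<⇒≢ K<K′ (sym (ℤP.+-injective (ℤP.i-j≡0⇒i≡j (+ K′) (+ K) K′-K≡0)))) ,
        λ n → ∣-resp-≡ (eq (+ K′) (+ K) (residue β n) (+ j (toℕ i)) (+ j (toℕ i′)))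
          (progressions-agree (t ℕ.* toℕ i) 1 K K′ (j (toℕ i)) (j (toℕ i′))
            (trans (k^i≡ (toℕ i)) (sym (ℕP.*-identityʳ (p ^ (t ℕ.* toℕ i))))) ¬P1∣1
            (∣-difference-sym (residue β (t ℕ.* toℕ i)) (+ j (toℕ i)) (mod-P-∣ (t ℕ.* toℕ i) (residue β (t ℕ.* toℕ i)))) agree n)
        where
        K = (p ^ t) ^ toℕ i
        K′ = (p ^ t) ^ toℕ i′
        K<K′ : K < K′
        K<K′ = ℕP.^-monoʳ-< (p ^ t) (ℕP.<-≤-trans 1<p (ℕP.≤-trans (ℕP.≤-reflexive (sym (ℕP.*-identityʳ p)))
          (ℕP.^-monoʳ-≤ p {{prime⇒nonZero p-prime}} 1≤t))) i<i′
        eq : ∀ K′ K β j j′ → (K′ - K) * β - (K′ * j - K * j′) ≡ K′ * (β - j) - K * (β - j′)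
        eq = solve-∀

    -- One deep level contains `suc W` offsets `j s`, all congruent to `β` modulo `p^(ti)`. Two of
    -- them must agree modulo `M + 2`, and with the same `K` on both sides this makes the offsets
    -- equal.
    mixed-case : ∀ t κ → 1 < κ → ¬ P 1 ∣ + κ → ¬ Covered (Kernel (p ^ t ℕ.* κ) b)
    mixed-case t κ 1<κ ¬d (gs , K⊆) = from-repetition
        (proj₂ (span-pigeonhole gs (suc (suc M))) (λ s → elt (toℕ s)) (λ s → K⊆ (elt∈ s)))
      where
      W i K r : ℕ
      W = proj₁ (span-pigeonhole gs (suc (suc M)))
      -- By `n < κ^n` this depth gives `suc W <= κ^i`, which keeps all `j s` below `K`.
      i = suc W
      K = (p ^ t ℕ.* κ) ^ i
      K≡ : K ≡ p ^ (t ℕ.* i) ℕ.* κ ^ i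
      K≡ = trans (^-distribʳ-* (p ^ t) κ i) (cong (ℕ._* κ ^ i) (ℕP.^-*-assoc p t i))
      r = mod-P (t ℕ.* i) (residue β (t ℕ.* i))
      j : ℕ → ℕ
      j s = p ^ (t ℕ.* i) ℕ.* s ℕ.+ r
      j<K : ∀ s → s < suc W → j s < K
      j<K s s≤W = begin-strict
        p ^ (t ℕ.* i) ℕ.* s ℕ.+ r               <⟨ ℕP.+-monoʳ-< (p ^ (t ℕ.* i) ℕ.* s) (mod-P-< (t ℕ.* i) (residue β (t ℕ.* i))) ⟩
        p ^ (t ℕ.* i) ℕ.* s ℕ.+ p ^ (t ℕ.* i)   ≡⟨ ℕP.+-comm (p ^ (t ℕ.* i) ℕ.* s) (p ^ (t ℕ.* i)) ⟩
        p ^ (t ℕ.* i) ℕ.+ p ^ (t ℕ.* i) ℕ.* s   ≡⟨ ℕP.*-suc (p ^ (t ℕ.* i)) s ⟨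
        p ^ (t ℕ.* i) ℕ.* suc s                 ≤⟨ ℕP.*-monoʳ-≤ (p ^ (t ℕ.* i)) (ℕP.≤-trans s≤W (ℕP.<⇒≤ (n<m^n 1<κ i))) ⟩
        p ^ (t ℕ.* i) ℕ.* κ ^ i                 ≡⟨ K≡ ⟨
        K                                       ∎
        where open ℕP.≤-Reasoning
      elt : ℕ → Seq
      elt s n = b (K ℕ.* n ℕ.+ j s)
      elt∈ : ∀ (s : Fin (suc W)) → Kernel (p ^ t ℕ.* κ) b (elt (toℕ s))
      elt∈ s = i , j (toℕ s) , j<K (toℕ s) (FinP.toℕ<n s) , λ _ → refl
      near : ∀ s → Ord≥ (t ℕ.* i) (nat (j s) ⊖ β)
      near s = ∣-resp-≡ (trans (cong (_- B) (pos-linear (p ^ (t ℕ.* i)) s r)) (eq (P (t ℕ.* i)) (+ s) (+ r) B))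
        (∣m∣n⇒∣m-n (∣m⇒∣m*n (+ s) ∣-refl) (mod-P-∣ (t ℕ.* i) B))
        where
        B = residue β (t ℕ.* i)
        eq : ∀ k s r B → (k * s + r) - B ≡ k * s - (B - r)
        eq = solve-∀
      from-repetition : ¬ (Σ[ s ∈ Fin (suc W) ] Σ[ s′ ∈ Fin (suc W) ] s Fin.< s′ × (∀ n → + suc (suc M) ∣ elt (toℕ s) n - elt (toℕ s′) n))
      from-repetition (s , s′ , s<s′ , agree) = ℕP.<⇒≢ j<j′ (sym j′≡j)
        where
        j<j′ : j (toℕ s) < j (toℕ s′)
        j<j′ = ℕP.+-monoˡ-< r (ℕP.*-monoʳ-< (p ^ (t ℕ.* i)) {{P-nonZero (t ℕ.* i)}} s<s′)
        eq : ∀ K β j j′ → K * (j′ - j) ≡ K * (β - j) - K * (β - j′)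
        eq = solve-∀
        product≡0 : + K * (+ j (toℕ s′) - + j (toℕ s)) ≡ + 0
        product≡0 = P-∣-all⇒0 (+ K * (+ j (toℕ s′) - + j (toℕ s))) λ n →
          ∣-resp-≡ (eq (+ K) (residue β n) (+ j (toℕ s)) (+ j (toℕ s′)))
            (progressions-agree (t ℕ.* i) (κ ^ i) K K (j (toℕ s)) (j (toℕ s′)) K≡ (¬P1∣-^ κ i ¬d) (near (toℕ s)) agree n)
        j′≡j : j (toℕ s′) ≡ j (toℕ s)
        j′≡j = cancel-factor K (j (toℕ s′)) (j (toℕ s))
          (λ K≡0 → ℕP.<⇒≢ (ℕP.≤-<-trans z≤n (j<K (toℕ s) (FinP.toℕ<n s))) (sym K≡0)) product≡0

    peak⇒power-and-rational : ∀ k → 2 ≤ k → Covered (Kernel k b) → (∃[ t ] 1 ≤ t × k ≡ p ^ t) × Rational′ β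
    peak⇒power-and-rational k 2≤k covered with ≉0⇒Ord em {nat k} (int-≉0 λ k≡0 → ℕP.n>0⇒n≢0 (ℕP.<⇒≤ 2≤k) (ℤP.+-injective k≡0))
    ... | t , d , ¬d with ∣⇒∣ᵤ d
    ...   | ℕD.divides κ k≡ = by-cofactor κ (trans k≡ (ℕP.*-comm κ (p ^ t)))
              (exact-unit-part {t} ¬d (trans (cong +_ k≡) (ℤP.pos-* κ (p ^ t))))
      where
      t-positive : ∀ t → 2 ≤ p ^ t → 1 ≤ t
      t-positive zero (s≤s ())
      t-positive (suc t) _ = s≤s z≤n
      by-cofactor : ∀ κ → k ≡ p ^ t ℕ.* κ → ¬ P 1 ∣ + κ → (∃[ t ] 1 ≤ t × k ≡ p ^ t) × Rational′ β
      by-cofactor zero _ ¬d = ⊥-elim (¬d (divides (+ 0) refl))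
      by-cofactor 1 k≡ _ = (t , 1≤t , k≡p^t) , power-case t 1≤t (subst (λ k → Covered (Kernel k b)) k≡p^t covered)
        where
        k≡p^t : k ≡ p ^ t
        k≡p^t = trans k≡ (ℕP.*-identityʳ (p ^ t))
        1≤t : 1 ≤ t
        1≤t = t-positive t (subst (2 ≤_) k≡p^t 2≤k)
      by-cofactor κ@(suc (suc _)) k≡ ¬d = ⊥-elim
        (mixed-case t κ (s≤s (s≤s z≤n)) ¬d (subst (λ k → Covered (Kernel k b)) k≡ covered))

-- Regularity near rational roots

quotient-unique : ∀ l r r′ a b → r < l → r′ < l → + r + a * + l ≡ + r′ + b * + l → a ≡ b
quotient-unique l r r′ a b r<l r′<l e = ℤP.i-j≡0⇒i≡j a b (ℤP.∣i∣≡0⇒i≡0 (small ℤ.∣ a - b ∣ bound))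
  where
  difference : (a - b) * + l ≡ + r′ - + r
  difference = trans (lemma a b (+ l) (+ r)) (trans (cong (λ t → t - b * + l - + r) e) (lemma′ (+ r′) b (+ l) (+ r)))
    where
    lemma : ∀ a b l r → (a - b) * l ≡ (r + a * l) - b * l - r
    lemma = solve-∀
    lemma′ : ∀ r′ b l r → (r′ + b * l) - b * l - r ≡ r′ - r
    lemma′ = solve-∀
  bound : ℤ.∣ a - b ∣ ℕ.* l < l
  bound = begin-strict
    ℤ.∣ a - b ∣ ℕ.* l       ≡⟨ ℤP.abs-* (a - b) (+ l) ⟨
    ℤ.∣ (a - b) * + l ∣     ≡⟨ cong ℤ.∣_∣ (trans difference (ℤP.m-n≡m⊖n r′ r)) ⟩
    ℤ.∣ r′ ℤ.⊖ r ∣          ≤⟨ ℤP.∣m⊝n∣≤m⊔n r′ r ⟩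
    r′ ℕ.⊔ r                <⟨ ℕP.⊔-lub r′<l r<l ⟩
    l                       ∎
    where open ℕP.≤-Reasoning
  small : ∀ k → k ℕ.* l < l → k ≡ 0
  small zero _ = refl
  small (suc k) h = ⊥-elim (ℕP.m+n≮m l (k ℕ.* l) h)

[z+m*l]/ℕl : ∀ z m l .{{_ : NonZero l}} → (z + m * + l) /ℕ l ≡ z /ℕ l + m
[z+m*l]/ℕl z m l = quotient-unique l ((z + m * + l) %ℕ l) (z %ℕ l) ((z + m * + l) /ℕ l) (z /ℕ l + m)
  (n%ℕd<d (z + m * + l) l) (n%ℕd<d z l)
  (trans (sym (a≡a%ℕn+[a/ℕn]*n (z + m * + l) l))
    (trans (cong (_+ m * + l) (a≡a%ℕn+[a/ℕn]*n z l)) (eq (+ (z %ℕ l)) (z /ℕ l) m (+ l))))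
  where
  eq : ∀ r q m l → (r + q * l) + m * l ≡ r + (q + m) * l
  eq = solve-∀

quasiperiodic-multiple : ∀ {ψ : ℕ → ℤ} {l M} → (∀ v → ψ (v ℕ.+ l) ≡ ψ v + M) →
  ∀ h v → ψ (v ℕ.+ h ℕ.* l) ≡ ψ v + + h * M
quasiperiodic-multiple {ψ} {l} {M} q zero v = trans (cong ψ (ℕP.+-identityʳ v)) (eq (ψ v) M)
  where
  eq : ∀ x m → x ≡ x + + 0 * m
  eq = solve-∀
quasiperiodic-multiple {ψ} {l} {M} q (suc h) v = begin
  ψ (v ℕ.+ (l ℕ.+ h ℕ.* l))   ≡⟨ cong ψ (ℕP.+-assoc v l (h ℕ.* l)) ⟨
  ψ (v ℕ.+ l ℕ.+ h ℕ.* l)     ≡⟨ quasiperiodic-multiple {ψ} {l} {M} q h (v ℕ.+ l) ⟩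
  ψ (v ℕ.+ l) + + h * M       ≡⟨ cong (_+ + h * M) (q v) ⟩
  ψ v + M + + h * M           ≡⟨ eq (ψ v) M (+ h) ⟩
  ψ v + (+ 1 + + h) * M       ∎
  where
  open ≡-Reasoning
  eq : ∀ x m h → x + m + h * m ≡ x + (+ 1 + h) * m
  eq = solve-∀

covered-constants : Covered (λ s → ∃[ c ] ∀ n → s n ≡ c)
covered-constants = (λ _ → + 1) ∷ [] , λ { (c , s≡c) →
  respˢ (λ n → trans (ℤP.*-identityʳ c) (sym (s≡c n))) (scaleˢ c (generator (here refl))) }

covered-singleton : ∀ t → Covered (λ s → s ≗ t)
covered-singleton t = t ∷ [] , λ s≗t → respˢ (λ n → sym (s≗t n)) (generator (here refl))

module Regularity (em : ExcludedMiddle 0ℓ) (p : ℕ) (p-prime : Prime p) where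

  open Valuation p p-prime
  open LocalForms p p-prime
  open PadicNumbers p p-prime
  open Irregularity em p p-prime

  -- From depth `E` on, the whole progression `p^i n + j` stays in the class of `j` modulo `p^E`,
  -- where one local form describes the sequence. Only finitely many kernel elements are less deep.
  Deep : Seq → ℕ → ℤ → Pred Seq 0ℓ
  Deep a E r s = ∃[ i ] ∃[ j ] E ≤ i × j < p ^ i × P E ∣ + j - r × s ≗ (λ n → a (p ^ i ℕ.* n ℕ.+ j))

  covered-kernel : ∀ a E → (∀ r → Covered (Deep a E r)) → Covered (Kernel p a)
  covered-kernel a E deep = covered-⊆ by-level
    (covered-∪
      (covered-⋃< E _ λ i → covered-⋃< (p ^ i) _ λ j → covered-singleton (λ n → a (p ^ i ℕ.* n ℕ.+ j)))
      (covered-⋃< (p ^ E) (λ r → Deep a E (+ r)) λ r → deep (+ r)))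
    where
    by-level : Kernel p a ⊆ ((λ s → ∃[ i ] i < E × ∃[ j ] j < p ^ i × s ≗ (λ n → a (p ^ i ℕ.* n ℕ.+ j)))
      ∪ (λ s → ∃[ r ] r < p ^ E × Deep a E (+ r) s))
    by-level (i , j , j<pⁱ , s≗) with ℕP.<-≤-connex i E
    ... | inj₁ i<E = inj₁ (i , i<E , j , j<pⁱ , s≗)
    ... | inj₂ E≤i = inj₂ (mod-P E (+ j) , mod-P-< E (+ j) , i , j , E≤i , j<pⁱ , mod-P-∣ E (+ j) , s≗)

  near-progression : ∀ E r i j n → E ≤ i → P E ∣ + j - r → Near E r (nat (p ^ i ℕ.* n ℕ.+ j))
  near-progression E r i j n E≤i j≡r = ∣-resp-≡
    (trans (cong (_- r) (pos-linear (p ^ i) n j)) (eq (P i) (+ n) (+ j) r))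
    (∣m∣n⇒∣m+n (∣m⇒∣m*n (+ n) (P-mono E≤i)) j≡r)
    where
    eq : ∀ k n j r → (k * n + j) - r ≡ k * n + (j - r)
    eq = solve-∀

  covered-deep-constant : ∀ a E r c → (∀ n → Near E r (nat n) → a n ≡ c) → Covered (Deep a E r)
  covered-deep-constant a E r c a≡c = covered-⊆
    (λ { (i , j , E≤i , _ , j≡r , s≗) → c , λ n →
      trans (s≗ n) (a≡c (p ^ i ℕ.* n ℕ.+ j) (near-progression E r i j n E≤i j≡r)) })
    covered-constants

  module _ (a : Seq) (E : ℕ) (r : ℤ) (α : Zp) (d : ℕ) (u : ℤ) (ψ : ℕ → ℤ) (l : ℕ) (M : ℤ)
    .{{_ : NonZero d}} .{{_ : NonZero l}}
    (dα≈u : int (+ d) ⊛ α ≈ int u)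
    (ψ-quasiperiodic : ∀ v → ψ (v ℕ.+ l) ≡ ψ v + M)
    (peak : ∀ n → Near E r (nat n) → ∀ v → Ord v (nat n ⊖ α) → a n ≡ ψ v) where

    -- The kernel element of index (i , j) depends, up to a constant and its
    -- value at a root, only on the integer w = (d j - u) / pⁱ, which is bounded,
    -- and on i mod l.
    Hit : ℤ → ℕ → Pred Seq 0ℓ
    Hit w ρ s = ∃[ i ] ∃[ j ] E ≤ i × P E ∣ + j - r × + d * + j - u ≡ w * P i × i ℕ.% l ≡ ρ ×
      s ≗ (λ n → a (p ^ i ℕ.* n ℕ.+ j))

    -- Replacing `d α` by the integer `u` turns `d` times the distance from the root into an
    -- ordinary integer with the explicit factor `p^i`.
    scaled-difference : ∀ w i j n → + d * + j - u ≡ w * P i →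
      int (+ d) ⊛ (nat (p ^ i ℕ.* n ℕ.+ j) ⊖ α) ≈ int (P i * (+ d * + n + w))
    scaled-difference w i j n dj-u≡ k = ∣-resp-≡
      (trans (cong (λ t → + d * (t - residue α k) - P i * (+ d * + n + w)) (pos-linear (p ^ i) n j))
        (eq (+ d) (P i) (+ n) (+ j) (residue α k) w u (+ d * + j - u - w * P i)
          refl (ℤP.i≡j⇒i-j≡0 dj-u≡)))
      (∣m⇒∣-m (dα≈u k))
      where
      lemma : ∀ d q n j α w u → d * (q * n + j - α) - q * (d * n + w) ≡ (d * j - u - w * q) + - (d * α - u)
      lemma = solve-∀
      eq : ∀ d q n j α w u z → z ≡ d * j - u - w * q → z ≡ + 0 →
        d * (q * n + j - α) - q * (d * n + w) ≡ - (d * α - u)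
      eq d q n j α w u z z≡ z≡0 = trans (lemma d q n j α w u)
        (trans (cong (_+ - (d * α - u)) (trans (sym z≡) z≡0)) (ℤP.+-identityˡ (- (d * α - u))))

    d≢0 : + d ≢ + 0
    d≢0 d≡0 = ℕ.≢-nonZero⁻¹ d (ℤP.+-injective d≡0)

    P≢0 : ∀ i → P i ≢ + 0
    P≢0 i P≡0 = ℕ.≢-nonZero⁻¹ (p ^ i) {{P-nonZero i}} (ℤP.+-injective P≡0)

    off-root : ∀ w i j n → + d * + j - u ≡ w * P i → + d * + n + w ≢ + 0 →
      ¬ nat (p ^ i ℕ.* n ℕ.+ j) ⊖ α ≈ int (+ 0)
    off-root w i j n dj-u≡ dn+w≢0 x≈0 = zero-product
      (int-injective {P i * (+ d * + n + w)} {+ 0}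
        (≈-trans {int (P i * (+ d * + n + w))} {int (+ d) ⊛ x} {int (+ 0)}
          (≈-sym {int (+ d) ⊛ x} {int (P i * (+ d * + n + w))} (scaled-difference w i j n dj-u≡))
          λ k → ∣-resp-≡ (eq (+ d) (residue x k)) (∣n⇒∣m*n (+ d) (x≈0 k))))
      where
      x = nat (p ^ i ℕ.* n ℕ.+ j) ⊖ α
      eq : ∀ d x → d * x - + 0 ≡ d * (x - + 0)
      eq = solve-∀
      zero-product : ¬ P i * (+ d * + n + w) ≡ + 0
      zero-product e with ℤP.i*j≡0⇒i≡0∨j≡0 (P i) e
      ... | inj₁ P≡0 = P≢0 i P≡0
      ... | inj₂ e′ = dn+w≢0 e′

    -- Up to the common factor `d`, the two distances are `p^i` and `p^i₀` times the same integer
    -- `d n + w`, so their orders differ by `i - i₀` for all `n` at once.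
    cross-multiple : ∀ w i j i₀ j₀ n → + d * + j - u ≡ w * P i → + d * + j₀ - u ≡ w * P i₀ →
      int (P i₀) ⊛ (nat (p ^ i ℕ.* n ℕ.+ j) ⊖ α) ≈ int (P i) ⊛ (nat (p ^ i₀ ℕ.* n ℕ.+ j₀) ⊖ α)
    cross-multiple w i j i₀ j₀ n e e₀ = ⊛-cancel em {int (P i₀) ⊛ x} {int (P i) ⊛ x₀} {int (+ d)} (int-≉0 d≢0) λ k →
      ∣-resp-≡ (eq (+ d) (P i₀) (P i) (residue x k) (residue x₀ k) (+ d * + n + w))
        (∣m∣n⇒∣m-n (∣n⇒∣m*n (P i₀) (scaled-difference w i j n e k)) (∣n⇒∣m*n (P i) (scaled-difference w i₀ j₀ n e₀ k)))
      where
      x = nat (p ^ i ℕ.* n ℕ.+ j) ⊖ α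
      x₀ = nat (p ^ i₀ ℕ.* n ℕ.+ j₀) ⊖ α
      eq : ∀ d q₀ q x x₀ y → d * (q₀ * x) - d * (q * x₀) ≡ q₀ * (d * x - q * y) - q * (d * x₀ - q₀ * y)
      eq = solve-∀

    -- `v - v₀ = i - i₀` is `l` times the difference of the quotients of `i` and `i₀` by `l`. To
    -- stay in the natural numbers, `(i₀ / l) l` is added to `v` and `(i / l) l` to `v₀`, after
    -- which the arguments coincide.
    level-shift : ∀ i i₀ v v₀ → i ℕ.% l ≡ i₀ ℕ.% l → i₀ ℕ.+ v ≡ i ℕ.+ v₀ →
      ψ v ≡ ψ v₀ + (+ (i ℕ./ l) - + (i₀ ℕ./ l)) * M
    level-shift i i₀ v v₀ i≡i₀ levels = solve-for (ψ v) (ψ v₀) (+ (i₀ ℕ./ l)) (+ (i ℕ./ l)) M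
      (trans (sym (quasiperiodic-multiple {ψ} {l} {M} ψ-quasiperiodic (i₀ ℕ./ l) v))
        (trans (cong ψ shifts) (quasiperiodic-multiple {ψ} {l} {M} ψ-quasiperiodic (i ℕ./ l) v₀)))
      where
      swap : ∀ ρ q v → ρ ℕ.+ q ℕ.+ v ≡ ρ ℕ.+ (v ℕ.+ q)
      swap = ℕ-solve-∀
      shifts : v ℕ.+ i₀ ℕ./ l ℕ.* l ≡ v₀ ℕ.+ i ℕ./ l ℕ.* l
      shifts = ℕP.+-cancelˡ-≡ (i ℕ.% l) _ _ (begin
        i ℕ.% l ℕ.+ (v ℕ.+ i₀ ℕ./ l ℕ.* l)     ≡⟨ cong (ℕ._+ (v ℕ.+ i₀ ℕ./ l ℕ.* l)) i≡i₀ ⟩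
        i₀ ℕ.% l ℕ.+ (v ℕ.+ i₀ ℕ./ l ℕ.* l)    ≡⟨ swap (i₀ ℕ.% l) (i₀ ℕ./ l ℕ.* l) v ⟨
        i₀ ℕ.% l ℕ.+ i₀ ℕ./ l ℕ.* l ℕ.+ v      ≡⟨ cong (ℕ._+ v) (m≡m%n+[m/n]*n i₀ l) ⟨
        i₀ ℕ.+ v                               ≡⟨ levels ⟩
        i ℕ.+ v₀                               ≡⟨ cong (ℕ._+ v₀) (m≡m%n+[m/n]*n i l) ⟩
        i ℕ.% l ℕ.+ i ℕ./ l ℕ.* l ℕ.+ v₀       ≡⟨ swap (i ℕ.% l) (i ℕ./ l ℕ.* l) v₀ ⟩
        i ℕ.% l ℕ.+ (v₀ ℕ.+ i ℕ./ l ℕ.* l)     ∎)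
        where open ≡-Reasoning
      rearrange : ∀ x h m → x ≡ (x + h * m) - h * m
      rearrange = solve-∀
      collect : ∀ y k h m → (y + k * m) - h * m ≡ y + (k - h) * m
      collect = solve-∀
      solve-for : ∀ x y h k m → x + h * m ≡ y + k * m → x ≡ y + (k - h) * m
      solve-for x y h k m e = trans (rearrange x h m) (trans (cong (_- h * m) e) (collect y k h m))

    -- At most one `n` satisfies `d n + w = 0`; for a hit, `p^i n + j` is then the root `α` itself,
    -- where the value of `a` is unconstrained.
    δ : ℤ → Seq
    δ w n = ⟦ + d * + n + w ℤP.≟ + 0 ⟧

    supported⇒multiple-of-δ : ∀ w (g : Seq) → (∀ n → + d * + n + w ≢ + 0 → g n ≡ + 0) → ∃[ c ] ∀ n → g n ≡ c * δ w n
    supported⇒multiple-of-δ w g supported = by-root (em {∃[ n ] + d * + n + w ≡ + 0})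
      where
      off : ∀ c n → + d * + n + w ≢ + 0 → g n ≡ c * δ w n
      off c n dn+w≢0 = trans (supported n dn+w≢0)
        (sym (trans (cong (c *_) (⟦⟧-no (+ d * + n + w ℤP.≟ + 0) dn+w≢0)) (ℤP.*-zeroʳ c)))
      unique : ∀ n n₀ → + d * + n + w ≡ + 0 → + d * + n₀ + w ≡ + 0 → n ≡ n₀
      unique n n₀ e e₀ = cancel-factor d n n₀ (ℕ.≢-nonZero⁻¹ d) (trans (eq (+ d) (+ n) (+ n₀) w) (cong₂ _-_ e e₀))
        where
        eq : ∀ d n n₀ w → d * (n - n₀) ≡ (d * n + w) - (d * n₀ + w)
        eq = solve-∀
      by-root : Dec (∃[ n ] + d * + n + w ≡ + 0) → ∃[ c ] ∀ n → g n ≡ c * δ w n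
      by-root (no ¬root) = + 0 , λ n → off (+ 0) n (λ e → ¬root (n , e))
      by-root (yes (n₀ , e₀)) = g n₀ , λ n → at n (+ d * + n + w ℤP.≟ + 0)
        where
        at : ∀ n → Dec (+ d * + n + w ≡ + 0) → g n ≡ g n₀ * δ w n
        at n (no ≢0) = off (g n₀) n ≢0
        at n (yes e) = trans (cong g (unique n n₀ e e₀))
          (sym (trans (cong (g n₀ *_) (⟦⟧-yes (+ d * + n + w ℤP.≟ + 0) e)) (ℤP.*-identityʳ (g n₀))))

    hit-difference : ∀ w ρ {s s₀} → Hit w ρ s → Hit w ρ s₀ →
      ∃[ h ] ∀ n → + d * + n + w ≢ + 0 → s n ≡ s₀ n + h
    hit-difference w ρ {s} {s₀} (i , j , E≤i , j≡r , e , i≡ρ , s≗) (i₀ , j₀ , E≤i₀ , j₀≡r , e₀ , i₀≡ρ , s₀≗) =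
      (+ (i ℕ./ l) - + (i₀ ℕ./ l)) * M , λ n ≢0 → at n
        (≉0⇒Ord em {x n} (off-root w i j n e ≢0)) (≉0⇒Ord em {x₀ n} (off-root w i₀ j₀ n e₀ ≢0))
      where
      x x₀ : ℕ → Zp
      x n = nat (p ^ i ℕ.* n ℕ.+ j) ⊖ α
      x₀ n = nat (p ^ i₀ ℕ.* n ℕ.+ j₀) ⊖ α
      at : ∀ n → ∃[ v ] Ord v (x n) → ∃[ v ] Ord v (x₀ n) → s n ≡ s₀ n + (+ (i ℕ./ l) - + (i₀ ℕ./ l)) * M
      at n (v , o) (v₀ , o₀) = begin
        s n                                                ≡⟨ s≗ n ⟩
        a (p ^ i ℕ.* n ℕ.+ j)                              ≡⟨ peak (p ^ i ℕ.* n ℕ.+ j) (near-progression E r i j n E≤i j≡r) v o ⟩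
        ψ v                                                ≡⟨ level-shift i i₀ v v₀ (trans i≡ρ (sym i₀≡ρ)) levels ⟩
        ψ v₀ + (+ (i ℕ./ l) - + (i₀ ℕ./ l)) * M            ≡⟨ cong (_+ (+ (i ℕ./ l) - + (i₀ ℕ./ l)) * M)
          (trans (s₀≗ n) (peak (p ^ i₀ ℕ.* n ℕ.+ j₀) (near-progression E r i₀ j₀ n E≤i₀ j₀≡r) v₀ o₀)) ⟨
        s₀ n + (+ (i ℕ./ l) - + (i₀ ℕ./ l)) * M            ∎
        where
        open ≡-Reasoning
        levels : i₀ ℕ.+ v ≡ i ℕ.+ v₀
        levels = Ord-unique {int (P i) ⊛ x₀ n}
          (Ord-resp-≈ {int (P i₀) ⊛ x n} {int (P i) ⊛ x₀ n} (cross-multiple w i j i₀ j₀ n e e₀)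
            (Ord-* {int (P i₀)} {x n} (Ord-P i₀) o))
          (Ord-* {int (P i)} {x₀ n} (Ord-P i) o₀)

    -- All hits with the same `w` and `ρ` agree up to a constant and a multiple of `δ w`, so an
    -- arbitrary one serves as base point; whether there is one is decided by excluded middle.
    covered-hit : ∀ w ρ → Covered (Hit w ρ)
    covered-hit w ρ = by-existence (em {∃ (Hit w ρ)})
      where
      by-existence : Dec (∃ (Hit w ρ)) → Covered (Hit w ρ)
      by-existence (no ¬hit) = [] , λ {s} hit → ⊥-elim (¬hit (s , hit))
      by-existence (yes (s₀ , hit₀)) = s₀ ∷ (λ _ → + 1) ∷ δ w ∷ [] , λ {s} hit → assemble s (hit-difference w ρ hit hit₀)
        where
        assemble : ∀ s → ∃[ h ] (∀ n → + d * + n + w ≢ + 0 → s n ≡ s₀ n + h) → ⟨ _ ⟩ s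
        assemble s (h , s≡) with supported⇒multiple-of-δ w (λ n → s n - (s₀ n + h)) (λ n ≢0 → ℤP.i≡j⇒i-j≡0 (s≡ n ≢0))
        ... | c , g≡ = respˢ
          (λ n → trans (cong (λ t → (s₀ n + h * + 1) + t) (sym (g≡ n))) (eq (s n) (s₀ n) h))
          (addˢ (addˢ (generator (here refl)) (scaleˢ h (generator (there (here refl)))))
            (scaleˢ c (generator (there (there (here refl))))))
          where
          eq : ∀ s s₀ h → (s₀ + h * + 1) + (s - (s₀ + h)) ≡ s
          eq = solve-∀

    bound : ℕ
    bound = suc (d ℕ.+ ℤ.∣ u ∣)

    -- As `j < p^i`, both `d j` and `|u|` are at most `p^i` times `d` and `|u|` respectively, and
    -- `p^i` cancels.
    w-bound : ∀ i j w → j < p ^ i → + d * + j - u ≡ w * P i → ℤ.∣ w ∣ < bound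
    w-bound i j w j<pⁱ e = s≤s (ℕP.*-cancelʳ-≤ ℤ.∣ w ∣ (d ℕ.+ ℤ.∣ u ∣) (p ^ i) {{P-nonZero i}} (begin
      ℤ.∣ w ∣ ℕ.* p ^ i                        ≡⟨ ℤP.abs-* w (P i) ⟨
      ℤ.∣ w * P i ∣                            ≡⟨ cong ℤ.∣_∣ e ⟨
      ℤ.∣ + d * + j - u ∣                      ≤⟨ ℤP.∣i-j∣≤∣i∣+∣j∣ (+ d * + j) u ⟩
      ℤ.∣ + d * + j ∣ ℕ.+ ℤ.∣ u ∣              ≡⟨ cong (ℕ._+ ℤ.∣ u ∣) (ℤP.abs-* (+ d) (+ j)) ⟩
      d ℕ.* j ℕ.+ ℤ.∣ u ∣                      ≤⟨ ℕP.+-mono-≤ (ℕP.*-monoʳ-≤ d (ℕP.<⇒≤ j<pⁱ)) (ℕP.m≤m*n ℤ.∣ u ∣ (p ^ i) {{P-nonZero i}}) ⟩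
      d ℕ.* p ^ i ℕ.+ ℤ.∣ u ∣ ℕ.* p ^ i        ≡⟨ ℕP.*-distribʳ-+ (p ^ i) d ℤ.∣ u ∣ ⟨
      (d ℕ.+ ℤ.∣ u ∣) ℕ.* p ^ i                ∎))
      where open ℕP.≤-Reasoning

    AnyHit : Pred Seq 0ℓ
    AnyHit s = ∃[ k ] k < bound × ∃[ ρ ] ρ < l × (Hit (+ k) ρ s ⊎ Hit (- + k) ρ s)

    covered-any-hit : Covered AnyHit
    covered-any-hit = covered-⋃< bound (λ k s → ∃[ ρ ] ρ < l × (Hit (+ k) ρ s ⊎ Hit (- + k) ρ s)) λ k →
      covered-⋃< l (λ ρ s → Hit (+ k) ρ s ⊎ Hit (- + k) ρ s) λ ρ → covered-∪ (covered-hit (+ k) ρ) (covered-hit (- + k) ρ)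

    covered-deep-rational : Covered (Deep a E r)
    covered-deep-rational = covered-⊆ hit-or-constant (covered-∪ covered-constants covered-any-hit)
      where
      signed-hit : ∀ w ρ {s} → Hit w ρ s → Hit (+ ℤ.∣ w ∣) ρ s ⊎ Hit (- + ℤ.∣ w ∣) ρ s
      signed-hit (+ k) ρ hit = inj₁ hit
      signed-hit -[1+ k ] ρ hit = inj₂ hit
      hit-or-constant : Deep a E r ⊆ ((λ s → ∃[ c ] ∀ n → s n ≡ c) ∪ AnyHit)
      hit-or-constant {s} (i , j , E≤i , j<pⁱ , j≡r , s≗) = by-distance (P i ∣? residue (nat j ⊖ α) i)
        where
        by-distance : Dec (P i ∣ residue (nat j ⊖ α) i) → (∃[ c ] ∀ n → s n ≡ c) ⊎ AnyHit s
        -- `j - α` has order below `i`, and adding `p^i n` does not change this order, so the kernel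
        -- element is constant.
        by-distance (no ¬d) = inj₁ (constant (¬Ord≥⇒Ord {nat j ⊖ α} i ¬d))
          where
          constant : ∃[ v ] v < i × Ord v (nat j ⊖ α) → ∃[ c ] ∀ n → s n ≡ c
          constant (v , v<i , o) = ψ v , λ n → trans (s≗ n)
            (peak (p ^ i ℕ.* n ℕ.+ j) (near-progression E r i j n E≤i j≡r) v
              (Ord-resp-≈ {(nat j ⊖ α) ⊕ int (P i * + n)} {nat (p ^ i ℕ.* n ℕ.+ j) ⊖ α}
                (≈-pointwise {(nat j ⊖ α) ⊕ int (P i * + n)} {nat (p ^ i ℕ.* n ℕ.+ j) ⊖ α} λ k →
                  trans (eq (+ j) (residue α k) (P i * + n)) (cong (_- residue α k) (sym (pos-linear (p ^ i) n j))))
                (Ord-⊕ {nat j ⊖ α} {int (P i * + n)} o (∣m⇒∣m*n (+ n) (P-mono v<i)))))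
            where
            eq : ∀ j α z → (j - α) + z ≡ (z + j) - α
            eq = solve-∀
        -- `p^i` divides `d (j - α)`, hence `d j - u`; the quotient is the index `w` of the hit.
        by-distance (yes d∣) = inj₂ (ℤ.∣ w ∣ , w-bound i j w j<pⁱ w≡ , i ℕ.% l , m%n<n i l ,
            signed-hit w (i ℕ.% l) (i , j , E≤i , j≡r , w≡ , refl , s≗))
          where
          eq : ∀ d j α u → d * j - u ≡ d * (j - α) + (d * α - u)
          eq = solve-∀
          divisible : P i ∣ + d * + j - u
          divisible = ∣-resp-≡ (eq (+ d) (+ j) (residue α i) u) (∣m∣n⇒∣m+n (∣n⇒∣m*n (+ d) d∣) (dα≈u i))
          w = quotient divisible
          w≡ : + d * + j - u ≡ w * P i
          w≡ = _∣_.equality divisible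

-- The three cases for valuation sequences

module Main (em : ExcludedMiddle 0ℓ) (p : ℕ) (p-prime : Prime p) where

  open Valuation p p-prime
  open LocalForms p p-prime
  open PadicNumbers p p-prime
  open Irregularity em p p-prime
  open Regularity em p p-prime

  -- Elements of `ℚ` are in lowest terms with positive denominator, so the sign is moved to the
  -- numerator and the greatest common divisor is cancelled.
  rational : ∀ {x} → Rational′ x → Rational p x
  rational {x} (d , u , d≢0 , dx≈u) = by-sign d d≢0 dx≈u
    where
    positive : ∀ k u → int (+ suc k) ⊛ x ≈ int u → Rational p x
    positive k u e = q , ⊛-cancel em {int (↧ q) ⊛ x} {int (↥ q)} {int g} (int-≉0 g≢0) λ n →
      ∣-resp-≡ (eq (↧ q) (↥ q) g (residue x n) (+ suc k) u (↧-/ u (suc k)) (↥-/ u (suc k))) (e n)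
      where
      q : ℚ
      q = u / suc k
      g : ℤ
      g = ℤG.gcd u (+ suc k)
      g≢0 : g ≢ + 0
      g≢0 g≡0 with trans (sym (↧-/ u (suc k))) (trans (cong (↧ q *_) g≡0) (ℤP.*-zeroʳ (↧ q)))
      ... | ()
      lemma : ∀ d n g x → g * (d * x) - g * n ≡ (d * g) * x - n * g
      lemma = solve-∀
      eq : ∀ d n g x D U → d * g ≡ D → n * g ≡ U → g * (d * x) - g * n ≡ D * x - U
      eq d n g x _ _ refl refl = lemma d n g x
    by-sign : ∀ d → d ≢ + 0 → int d ⊛ x ≈ int u → Rational p x
    by-sign (+ zero) d≢0 _ = ⊥-elim (d≢0 refl)
    by-sign (+ suc k) _ e = positive k u e
    by-sign -[1+ k ] _ e = positive k (- u) λ n → ∣-resp-≡ (eq (+ suc k) (residue x n) u) (∣m⇒∣-m (e n))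
      where
      eq : ∀ d x u → d * x - - u ≡ - (- d * x - u)
      eq = solve-∀

  -- Powers of `p + 1` are prime to `p`. This supplies a second base, at which a periodic sequence
  -- is still regular, so periodic sequences are not strictly regular.
  p-independent-suc : MultiplicativelyIndependent p (suc p)
  p-independent-suc zero c () _ _
  p-independent-suc (suc a) c _ _ e = ¬P1∣-^ (suc p) c ¬d
      (subst (λ t → P 1 ∣ + t) e (P-mono {1} {suc a} (s≤s z≤n)))
    where
    eq : ∀ x → + 1 ≡ (+ 1 + x) - x
    eq = solve-∀
    ¬d : ¬ P 1 ∣ + suc p
    ¬d d = ¬P1∣1 (∣-resp-≡ (eq (+ p)) (∣m∣n⇒∣m-n d
      (divides (+ 1) (trans (cong +_ (sym (ℕP.*-identityʳ p))) (sym (ℤP.*-identityˡ (P 1)))))))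

  periodic⇒¬strict : ∀ {a} → Periodic a → ¬ StrictlyRegularFor p a
  periodic⇒¬strict {a} per (_ , independent) = independent (suc p) (s≤s (ℕP.<⇒≤ 1<p)) p-independent-suc
    (periodic⇒regular em (s≤s (ℕP.<⇒≤ 1<p)) per)

  -- The class of `x` is rescaled to all of the p-adic integers: with `r` congruent to `x` modulo
  -- `p^E` and `β = (x - r) / p^E`, the sequence `a (p^E n + r)` is controlled by the order of
  -- `n - β` for every `n`. Regularity passes to this subsequence, and rationality of `β` passes
  -- back to `x`.
  irregular-at-root : ∀ {a E x ψ l M} → (∀ v → ψ (v ℕ.+ l) ≡ ψ v + + suc M) →
    (∀ n → Near E (residue x E) (nat n) → ∀ v → Ord v (nat n ⊖ x) → a n ≡ ψ v) →
    ∀ k → RegularFor k a → (∃[ t ] 1 ≤ t × k ≡ p ^ t) × Rational p x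
  irregular-at-root {a} {E} {x} {ψ} {l} {M} ψ-quasiperiodic peak k regular@(2≤k , _) =
      proj₁ conclusion , rational {x} (descend (proj₂ conclusion))
    where
    r = mod-P E (residue x E)
    quotient-by-P : ∃[ β ] x ⊖ nat r ≈ int (P E) ⊛ β
    quotient-by-P = divide-P E (x ⊖ nat r) (mod-P-∣ E (residue x E))
    β : Zp
    β = proj₁ quotient-by-P
    β≈ : x ⊖ nat r ≈ int (P E) ⊛ β
    β≈ = proj₂ quotient-by-P
    b : Seq
    b n = a (p ^ E ℕ.* n ℕ.+ r)
    φ : ℕ → ℤ
    φ v = ψ (E ℕ.+ v)
    φ-quasiperiodic : ∀ v → φ (v ℕ.+ l) ≡ φ v + + suc M
    φ-quasiperiodic v = trans (cong ψ (sym (ℕP.+-assoc E v l))) (ψ-quasiperiodic (E ℕ.+ v))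
    peak-b : ∀ n v → Ord v (nat n ⊖ β) → b n ≡ φ v
    peak-b n v o = peak (p ^ E ℕ.* n ℕ.+ r)
      (near-progression E (residue x E) E r n ℕP.≤-refl
        (∣-difference-sym (residue x E) (+ r) (mod-P-∣ E (residue x E)))) (E ℕ.+ v)
      (Ord-resp-≈ {int (P E) ⊛ (nat n ⊖ β)} {nat (p ^ E ℕ.* n ℕ.+ r) ⊖ x}
        (λ i → ∣-resp-≡ (trans
            (cong (λ t → P E * (+ n - residue β i) - (t - residue x i)) (pos-linear (p ^ E) n r))
            (eq (P E) (+ n) (residue β i) (residue x i) (+ r)))
          (β≈ i))
        (Ord-* {int (P E)} {nat n ⊖ β} (Ord-P E) o))
      where
      eq : ∀ q n β x r → q * (n - β) - ((q * n + r) - x) ≡ (x - r) - q * β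
      eq = solve-∀
    conclusion : (∃[ t ] 1 ≤ t × k ≡ p ^ t) × Rational′ β
    conclusion = peak⇒power-and-rational {b} {β} {φ} {l} {M} φ-quasiperiodic peak-b k 2≤k
      (kernel-progression k {{ℕ.>-nonZero (ℕP.<⇒≤ 2≤k)}} a (p ^ E) r (regular⇒covered {k} {a} regular))
    descend : Rational′ β → Rational′ x
    descend (d , u , d≢0 , dβ≈u) = d , d * + r + P E * u , d≢0 , λ n →
      ∣-resp-≡ (eq d (residue x n) (+ r) (P E) u (residue β n))
        (∣m∣n⇒∣m+n (∣n⇒∣m*n d (β≈ n)) (∣n⇒∣m*n (P E) (dβ≈u n)))
      where
      eq : ∀ d x r q u β → d * x - (d * r + q * u) ≡ d * ((x - r) - q * β) + q * (d * β - u)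
      eq = solve-∀

  module _ (f : Zp → ℚₚ p) (F : Series) (K E : ℕ) (F-rep : ∀ x → Rep K (f x) (value F x))
    (form : ∀ r → Form (value F) E r) where

    root⇒value≈0 : ∀ x → Roots p f x → value F x ≈ int (+ 0)
    root⇒value≈0 x = ≈0⇒Rep-0 K (f x) {value F x} (F-rep x)

    value≈0⇒root : ∀ x → value F x ≈ int (+ 0) → Roots p f x
    value≈0⇒root x = Rep-0⇒≈0 K (f x) {value F x} (F-rep x)

    module _ (l : ℕ) .{{_ : NonZero l}} (a : Seq) (valuations : IsValuationSequence p l f a) where

      level : ℕ → ℤ
      level w = (+ w - + K) /ℕ l

      a≡level : ∀ n w → Ord w (value F (nat n)) → a n ≡ level w
      a≡level n w o = valuations n (+ w - + K) (Rep⇒HasValuation K (f (nat n)) {value F (nat n)} {w} (F-rep (nat n)) o)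

      -- Raising `v` by `l` raises the order by `suc m` times `l`, a multiple of the divisor, so the
      -- floor grows by exactly `suc m` whatever the remainder was.
      level-quasiperiodic : ∀ c m v → level (c ℕ.+ suc m ℕ.* (v ℕ.+ l)) ≡ level (c ℕ.+ suc m ℕ.* v) + + suc m
      level-quasiperiodic c m v = trans (cong (_/ℕ l) shift) ([z+m*l]/ℕl (+ (c ℕ.+ suc m ℕ.* v) - + K) (+ suc m) l)
        where
        distribute : ∀ c m v l → c ℕ.+ m ℕ.* (v ℕ.+ l) ≡ (c ℕ.+ m ℕ.* v) ℕ.+ m ℕ.* l
        distribute = ℕ-solve-∀
        eq : ∀ w z K → (w + z) - K ≡ (w - K) + z
        eq = solve-∀
        shift : + (c ℕ.+ suc m ℕ.* (v ℕ.+ l)) - + K ≡ (+ (c ℕ.+ suc m ℕ.* v) - + K) + + suc m * + l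
        shift = trans (cong (λ t → + t - + K) (distribute c (suc m) v l))
          (trans (cong (_- + K) (trans (ℤP.pos-+ (c ℕ.+ suc m ℕ.* v) (suc m ℕ.* l))
            (cong (λ t → + (c ℕ.+ suc m ℕ.* v) + t) (ℤP.pos-* (suc m) l))))
            (eq (+ (c ℕ.+ suc m ℕ.* v)) (+ suc m * + l) (+ K)))

      regular⇒power-and-rational : ∀ x → Roots p f x → ∀ k → RegularFor k a →
        (∃[ t ] 1 ≤ t × k ≡ p ^ t) × Rational p x
      regular⇒power-and-rational x root = by-form (form (residue x E))
        where
        Fx≈0 : value F x ≈ int (+ 0)
        Fx≈0 = root⇒value≈0 x root
        by-form : Form (value F) E (residue x E) → ∀ k → RegularFor k a → (∃[ t ] 1 ≤ t × k ≡ p ^ t) × Rational p x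
        by-form (inj₁ (c , constant)) = ⊥-elim (Ord⇒≉0 {value F x} (constant x (near-self x E)) Fx≈0)
        by-form (inj₂ (α , α-near , Fα≈0 , c , m , order)) =
          irregular-at-root {a} {E} {x} {λ v → level (c ℕ.+ suc m ℕ.* v)} {l} {m} (level-quasiperiodic c m)
            λ n near v o → a≡level n (c ℕ.+ suc m ℕ.* v) (order (nat n) near v
              (Ord-resp-≈ {nat n ⊖ x} {nat n ⊖ α} (λ i → ∣-resp-≡ (eq (+ n) (residue x i) (residue α i)) (∣m⇒∣-m (x≈α i))) o))
          where
          eq : ∀ n x α → (n - x) - (n - α) ≡ - (x - α)
          eq = solve-∀
          -- If `x` had a finite order of distance from `α`, the root form would give `F x` a finite
          -- order, although `F x` vanishes.
          x≈α : x ≈ α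
          x≈α = by-contradiction em λ x≉α → distinct (≉0⇒Ord em {x ⊖ α} (λ e → x≉α (⊖≈0⇒≈ {x} {α} e)))
            where
            distinct : ¬ (∃[ v ] Ord v (x ⊖ α))
            distinct (v , o) = Ord⇒≉0 {value F x} (order x (near-self x E) v o) Fx≈0

      no-roots⇒period : Empty (Roots p f) → HasPeriod a (p ^ E)
      no-roots⇒period empty = ℕP.m^n>0 p {{prime⇒nonZero p-prime}} E , λ n → by-form n (form (+ n))
        where
        by-form : ∀ n → Form (value F) E (+ n) → a (n ℕ.+ p ^ E) ≡ a n
        by-form n (inj₂ (α , _ , Fα≈0 , _)) = ⊥-elim (empty α (value≈0⇒root α Fα≈0))
        by-form n (inj₁ (c , constant)) = trans
          (a≡level (n ℕ.+ p ^ E) c (constant (nat (n ℕ.+ p ^ E))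
            (∣-resp-≡ (trans (cong (_- + n) (ℤP.pos-+ n (p ^ E))) (eq (+ n) (P E))) ∣-refl)))
          (sym (a≡level n c (constant (nat n) (∣-difference-refl (+ n)))))
          where
          eq : ∀ n q → (n + q) - n ≡ q
          eq = solve-∀

      rational-roots⇒regular : Roots p f ⊆ Rational p → RegularFor p a
      rational-roots⇒regular roots⊆ℚ = covered⇒regular em {p} {a} 1<p (covered-kernel a E λ r → by-form r (form r))
        where
        by-form : ∀ r → Form (value F) E r → Covered (Deep a E r)
        by-form r (inj₁ (c , constant)) = covered-deep-constant a E r (level c) λ n near →
          a≡level n c (constant (nat n) near)
        by-form r (inj₂ (α , _ , Fα≈0 , c , m , order)) = at-rational (roots⊆ℚ (value≈0⇒root α Fα≈0))
          where
          at-rational : Rational p α → Covered (Deep a E r)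
          at-rational (q , e) = covered-deep-rational a E r α (↧ₙ q) (↥ q) (λ v → level (c ℕ.+ suc m ℕ.* v)) l (+ suc m)
            e (level-quasiperiodic c m) λ n near v o → a≡level n (c ℕ.+ suc m ℕ.* v) (order (nat n) near v o)

      rational-roots⇒strict : Satisfiable (Roots p f) → Roots p f ⊆ Rational p → StrictlyRegularFor p a
      rational-roots⇒strict (x , root) roots⊆ℚ = rational-roots⇒regular roots⊆ℚ , λ m 2≤m independent regular →
        dependent m independent (proj₁ (regular⇒power-and-rational x root m regular))
        where
        dependent : ∀ m → MultiplicativelyIndependent p m → ¬ (∃[ t ] 1 ≤ t × m ≡ p ^ t)
        dependent m independent (t , 1≤t , m≡) = independent t 1 1≤t (s≤s z≤n) (trans (sym m≡) (sym (ℕP.*-identityʳ m)))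

      irrational-root⇒irregular : ¬ (Roots p f ⊆ Rational p) → ¬ Regular a
      irrational-root⇒irregular ¬roots⊆ℚ (k , regular) = ¬roots⊆ℚ λ {x} root →
        proj₂ (regular⇒power-and-rational x root k regular)

    -- The roots of `f` alone decide which of the three cases occurs, and the cases exclude each
    -- other: a periodic sequence is regular for every base, hence not strictly regular, and a
    -- strictly regular one is regular.
    regular-kinds : ∀ (l l′ : ℕ) .{{_ : NonZero l}} .{{_ : NonZero l′}} (a a′ : Seq) →
      IsValuationSequence p l f a → IsValuationSequence p l′ f a′ →
      (Periodic a ⇔ Periodic a′) × (StrictlyRegularFor p a ⇔ StrictlyRegularFor p a′) × ((¬ Regular a) ⇔ (¬ Regular a′))
    regular-kinds l l′ a a′ val val′ = by-roots (em {Satisfiable (Roots p f)}) (em {Roots p f ⊆ Rational p})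
      where
      both : ∀ {A B : Set} → A → B → A ⇔ B
      both x y = mk⇔ (λ _ → y) (λ _ → x)
      neither : ∀ {A B : Set} → ¬ A → ¬ B → A ⇔ B
      neither ¬x ¬y = mk⇔ (λ x → ⊥-elim (¬x x)) (λ y → ⊥-elim (¬y y))
      periodic⇒regular′ : ∀ {a} → Periodic a → Regular a
      periodic⇒regular′ {a} per = p , periodic⇒regular em {p} {a} 1<p per
      by-roots : Dec (Satisfiable (Roots p f)) → Dec (Roots p f ⊆ Rational p) →
        (Periodic a ⇔ Periodic a′) × (StrictlyRegularFor p a ⇔ StrictlyRegularFor p a′) × ((¬ Regular a) ⇔ (¬ Regular a′))
      by-roots (no ¬root) _ = both per per′ , neither (periodic⇒¬strict per) (periodic⇒¬strict per′) ,
        neither (λ ¬reg → ¬reg (periodic⇒regular′ per)) (λ ¬reg → ¬reg (periodic⇒regular′ per′))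
        where
        per : Periodic a
        per = p ^ E , no-roots⇒period l a val (λ x root → ¬root (x , root))
        per′ : Periodic a′
        per′ = p ^ E , no-roots⇒period l′ a′ val′ (λ x root → ¬root (x , root))
      by-roots (yes root) (yes roots⊆ℚ) =
        neither (λ per → periodic⇒¬strict per str) (λ per → periodic⇒¬strict per str′) , both str str′ ,
        neither (λ ¬reg → ¬reg (p , proj₁ str)) (λ ¬reg → ¬reg (p , proj₁ str′))
        where
        str : StrictlyRegularFor p a
        str = rational-roots⇒strict l a val root roots⊆ℚ
        str′ : StrictlyRegularFor p a′
        str′ = rational-roots⇒strict l′ a′ val′ root roots⊆ℚ
      by-roots (yes root) (no ¬roots⊆ℚ) =
        neither (λ per → ¬reg (periodic⇒regular′ per)) (λ per → ¬reg′ (periodic⇒regular′ per)) ,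
        neither (λ str → ¬reg (p , proj₁ str)) (λ str → ¬reg′ (p , proj₁ str)) , both ¬reg ¬reg′
        where
        ¬reg : ¬ Regular a
        ¬reg = irrational-root⇒irregular l a val ¬roots⊆ℚ
        ¬reg′ : ¬ Regular a′
        ¬reg′ = irrational-root⇒irregular l′ a′ val′ ¬roots⊆ℚ

theorem2p3 : ExcludedMiddle 0ℓ →
    (p : ℕ) → Prime p →
    (f : ℤₚ p → ℚₚ p) → Analytic p f → ¬ IdenticallyZero p f →
    ((l : ℕ) .{{_ : NonZero l}} →
    (a : ℕ → ℤ) → IsValuationSequence p l f a →
    (Empty (Roots p f) → ∃[ e ] HasPeriod a (p ^ e)) ×
    (Satisfiable (Roots p f) → Roots p f ⊆ Rational p → StrictlyRegularFor p a) ×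
    (¬ (Roots p f ⊆ Rational p) → ¬ Regular a)) ×
    ((l l′ : ℕ) .{{_ : NonZero l}} .{{_ : NonZero l′}} →
    (a a′ : ℕ → ℤ) → IsValuationSequence p l f a → IsValuationSequence p l′ f a′ →
    (Periodic a ⇔ Periodic a′) ×
    (StrictlyRegularFor p a ⇔ StrictlyRegularFor p a′) ×
    ((¬ Regular a) ⇔ (¬ Regular a′)))
theorem2p3 em p p-prime f (c , converges) f≢0 =
    (λ l a val → (λ empty → proj₁ E , no-roots⇒period f series K (proj₁ E) value-rep (proj₂ E) l a val empty) ,
      rational-roots⇒strict f series K (proj₁ E) value-rep (proj₂ E) l a val ,
      irrational-root⇒irregular f series K (proj₁ E) value-rep (proj₂ E) l a val) ,
    regular-kinds f series K (proj₁ E) value-rep (proj₂ E)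
  where
  open Main em p p-prime
  open LocalForms p p-prime
  open PadicNumbers p p-prime
  converges′ : ∀ x → ConvergesTo p (partialSum c x) (f x)
  converges′ x = subst (λ s → ConvergesTo p s (f x))
    {λ N → RawSemiringDefinitions.sum (RawRing.rawSemiring (ℚₚ-rawRing p)) {N} (λ i →
      RawRing._*_ (ℚₚ-rawRing p) (c (toℕ i))
        (RawSemiringDefinitions._^_ (RawRing.rawSemiring (ℚₚ-rawRing p)) (ι p x) (toℕ i)))}
    {partialSum c x} (sym (partialSum-≡ c x)) (converges x)
  open PowerSeries c f converges′
  degree : ∃[ N ] ∃[ V ] HasDegree series N V
  degree = has-degree em f≢0
  E : ∃[ E ] (∀ r → Form (value series) E r)
  E = uniform-form em series {proj₁ degree} {proj₁ (proj₂ degree)} (proj₂ (proj₂ degree))
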